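{- Let $A$ be an $n \times m$ unimodular matrix with $\operatorname{rank} A = n$. Let $\mathcal{P}_{A}$ be the family of all integer polyhedra $P \subseteq \mathbb{R}^{n}$ such that for every face $F$ of $P$, the subspace $\operatorname{span}(F)$ is generated by some column vectors of $A$ (for a vertex $F$, $\operatorname{span}(F)=\{0\}$ is generated by the empty set of columns). Let $\mathcal{C}_{A} = \{ P \cap \mathbb{Z}^{n} \mid P \in \mathcal{P}_{A} \}$. Then: (DCP1) each $P \in \mathcal{P}_{A}$ is an integer polyhedron; (DCP2) for any $P_{1}, P_{2} \in \mathcal{P}_{A}$, we have $P_{1}+P_{2} \in \mathcal{P}_{A}$ and $(P_{1}+P_{2}) \cap \mathbb{Z}^{n} = (P_{1} \cap \mathbb{Z}^{n}) + (P_{2} \cap \mathbb{Z}^{n})$; (DC1) for any $S \in \mathcal{C}_{A}$, the convex hull $\overline{S}$ is an integer polyhedron and $S = \overline{S} \cap \mathbb{Z}^{n}$; (DC2) for any $S_{1}, S_{2} \in \mathcal{C}_{A}$, we have $S_{1}+S_{2} \in \mathcal{C}_{A}$.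
   Context: An $n\times m$ integer matrix $A$ is unimodular if $\operatorname{rank}A=n$ and every $n\times n$ minor of $A$ lies in $\{0,+1,-1\}$. A polyhedron is a set $\{x \in \mathbb{R}^n \mid Cx \le b\}$ for a finite system of linear inequalities; it is rational if $C,b$ can be taken rational, and it is an integer polyhedron if $P = \overline{P \cap \mathbb{Z}^{n}}$, where $\overline{S}$ denotes the convex hull of $S$ (equivalently, $P$ is rational and every face of $P$ contains an integer point). For sets $S_1,S_2\subseteq\mathbb{R}^n$, $S_1+S_2=\{x+y \mid x\in S_1, y\in S_2\}$ is the Minkowski sum. For a nonempty set $F \subseteq \mathbb{R}^{n}$, $\operatorname{span}(F) = \{ \lambda (x-y) \mid x,y \in F, \lambda \in \mathbb{R}\}$, i.e., the linear subspace parallel to the affine hull of $F$. "Generated by column vectors of $A$" means equal to the linear span of some subset of the columns of $A$.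
   Formalization: Polyhedra are taken as subsets of ℚⁿ instead of ℝⁿ: points, defining inequalities, face normals, and the coefficients in convex hulls, spans and column combinations are all rational. -}

module Defs where

open import Data.Nat as ℕ using (ℕ; zero; suc)
open import Data.Fin using (Fin; zero; suc; punchIn)
open import Data.Bool using (Bool; true; false)
open import Data.Integer as ℤ using (ℤ)
open import Data.Rational as ℚ using (ℚ; _+_; _*_; _-_; _≤_; 0ℚ; 1ℚ)
open import Data.Product using (Σ; ∃; _×_; _,_)
open import Data.Sum using (_⊎_)
open import Relation.Binary.PropositionalEquality using (_≡_)

Matrix : ℕ → ℕ → Set
Matrix n m = Fin n → Fin m → ℤ

Σℤ : ∀ k → (Fin k → ℤ) → ℤ
Σℤ zero    f = ℤ.+ 0
Σℤ (suc k) f = f zero ℤ.+ Σℤ k (λ j → f (suc j))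

altSign : ∀ {k} → Fin k → ℤ
altSign zero    = ℤ.+ 1
altSign (suc j) = ℤ.- altSign j

det : ∀ k → Matrix k k → ℤ
det zero    M = ℤ.+ 1
det (suc k) M =
  Σℤ (suc k) (λ j → altSign j ℤ.* (M zero j ℤ.* det k (λ i l → M (suc i) (punchIn j l))))

-- an n × n minor of A: the determinant of the columns σ 0, …, σ (n-1)
-- (any choice of columns; repeated columns give determinant 0,
--  reorderings only change the sign)
minor : ∀ {n m} → Matrix n m → (Fin n → Fin m) → ℤ
minor {n} A σ = det n (λ i k → A i (σ k))

toℚ : ℤ → ℚ
toℚ z = z ℚ./ 1

Σℚ : ∀ k → (Fin k → ℚ) → ℚ
Σℚ zero    f = 0ℚ
Σℚ (suc k) f = f zero + Σℚ k (λ j → f (suc j))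

RankFull : ∀ {n m} → Matrix n m → Set
RankFull {n} {m} A =
  (y : Fin n → ℚ) → (∀ j → Σℚ n (λ i → y i * toℚ (A i j)) ≡ 0ℚ) → ∀ i → y i ≡ 0ℚ

Unimodular : ∀ {n m} → Matrix n m → Set
Unimodular A =
  RankFull A ×
  (∀ σ → (minor A σ ≡ ℤ.+ 0) ⊎ (minor A σ ≡ ℤ.+ 1) ⊎ (minor A σ ≡ ℤ.-[1+ 0 ]))

-- Points and sets in ℚⁿ (all polyhedra in the statement are rational)

Pt : ℕ → Set
Pt n = Fin n → ℚ

PSet : ℕ → Set₁
PSet n = Pt n → Set

_⊆_ : ∀ {n} → PSet n → PSet n → Set
S ⊆ T = ∀ x → S x → T x

_≐_ : ∀ {n} → PSet n → PSet n → Set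
S ≐ T = (S ⊆ T) × (T ⊆ S)

dot : ∀ {n} → Pt n → Pt n → ℚ
dot {n} c x = Σℚ n (λ i → c i * x i)

IsIntPt : ∀ {n} → Pt n → Set
IsIntPt x = ∀ i → ∃ λ (z : ℤ) → x i ≡ toℚ z

_∩ℤ : ∀ {n} → PSet n → PSet n
(P ∩ℤ) x = P x × IsIntPt x

_⊕_ : ∀ {n} → PSet n → PSet n → PSet n
(S₁ ⊕ S₂) x = ∃ λ y → ∃ λ z → S₁ y × S₂ z × (∀ i → x i ≡ y i + z i)

Conv : ∀ {n} → PSet n → PSet n
Conv {n} S x =
  ∃ λ (k : ℕ) → ∃ λ (p : Fin k → Pt n) → ∃ λ (μ : Fin k → ℚ) →
    (∀ j → S (p j)) × (∀ j → 0ℚ ≤ μ j) × (Σℚ k μ ≡ 1ℚ) ×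
    (∀ i → x i ≡ Σℚ k (λ j → μ j * p j i))

IsPolyhedron : ∀ {n} → PSet n → Set
IsPolyhedron {n} P =
  ∃ λ (k : ℕ) → ∃ λ (C : Fin k → Pt n) → ∃ λ (b : Fin k → ℚ) →
    P ≐ (λ x → ∀ r → dot (C r) x ≤ b r)

IsIntegerPolyhedron : ∀ {n} → PSet n → Set
IsIntegerPolyhedron P = IsPolyhedron P × (P ≐ Conv (P ∩ℤ))

IsFace : ∀ {n} → PSet n → PSet n → Set
IsFace {n} P F =
  (∃ λ x → F x) ×
  (∃ λ (c : Pt n) → ∃ λ (δ : ℚ) →
     (∀ x → P x → dot c x ≤ δ) × (F ≐ (λ x → P x × dot c x ≡ δ)))

SpanOf : ∀ {n} → PSet n → PSet n
SpanOf F v = ∃ λ (l : ℚ) → ∃ λ x → ∃ λ y → F x × F y × (∀ i → v i ≡ l * (x i - y i))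

ColSpan : ∀ {n m} → Matrix n m → (Fin m → Bool) → PSet n
ColSpan {n} {m} A T v =
  ∃ λ (coef : Fin m → ℚ) → (∀ j → T j ≡ false → coef j ≡ 0ℚ) ×
    (∀ i → v i ≡ Σℚ m (λ j → coef j * toℚ (A i j)))

InPA : ∀ {n m} → Matrix n m → PSet n → Set₁
InPA {n} {m} A P =
  IsIntegerPolyhedron P ×
  (∀ F → IsFace P F → ∃ λ (T : Fin m → Bool) → SpanOf F ≐ ColSpan A T)

InCA : ∀ {n m} → Matrix n m → PSet n → Set₁
InCA {n} A S = Σ (PSet n) λ P → InPA A P × (S ≐ (P ∩ℤ))

{-# OPTIONS --safe #-}

-- Let x be an integer point of P₁ + P₂ and Q the polyhedron of all y in P₁ with
-- x − y in P₂.  Given y in Q, the smallest faces of P₁ and P₂ containing y and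
-- x − y contain integer points z₁ and z₂, and their spans are generated by
-- columns T₁ and T₂ of A, so x − z₁ − z₂ lies in the span of T₁ ∪ T₂.
-- Extending a maximal independent subset of T₁ ∪ T₂ to a basis of columns,
-- whose determinant is ±1, Cramer's rule makes this an integral combination, so
-- x − z₁ − z₂ = u₁ + u₂ with uᵢ integral in the span of Tᵢ.  The integer point
-- y′ = z₁ + u₁ satisfies with equality all constraints of Q tight at y.  Either
-- y′ is in Q, or the segment from y to y′ leaves Q at a point where more
-- constraints are tight, and we start again from there.
--
-- The remaining properties of P₁ + P₂ hold because a face of P₁ + P₂ is a sum of
-- faces, Fourier–Motzkin elimination presents P₁ + P₂ by inequalities, and
-- Conv S + Conv T is contained in Conv (S + T).

module Submission where

open import Defs
open import Algebra.Core using (Op₁; Op₂)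
open import Algebra.Structures using (IsCommutativeRing)
open import Data.Bool using (Bool; true; false; _∨_; if_then_else_)
import Data.Bool.Properties as Bool
open import Data.Fin using (Fin; zero; suc; punchIn; remQuot; splitAt)
open import Data.Fin.Properties using (any?)
open import Data.Integer as ℤ using (ℤ)
import Data.Integer.Properties as ℤ
import Data.Integer.Tactic.RingSolver as ℤ-Solver
open import Data.Nat as ℕ using (ℕ; zero; suc)
import Data.Nat.Properties as ℕ
open import Data.Product using (_×_; _,_; ∃; proj₁; proj₂)
open import Data.Rational as ℚ using (ℚ; 0ℚ; 1ℚ)
import Data.Rational.Properties as ℚ
import Data.Rational.Unnormalised as ℚᵘ
import Data.Rational.Unnormalised.Properties as ℚᵘ
open import Data.Sum using (_⊎_; inj₁; inj₂; [_,_]′)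
open import Data.Vec.Functional using (Vector; _∷_; _++_)
open import Data.Vec.Functional.Relation.Unary.All using (All)
import Data.Vec.Functional.Relation.Unary.All.Properties as All
open import Function using (_∘_)
open import Level using (0ℓ)
open import Relation.Binary using (tri<; tri≈; tri>)
open import Relation.Binary.PropositionalEquality using (_≡_; _≢_; refl; sym; trans; cong; cong₂; subst; subst₂; module ≡-Reasoning)
open import Relation.Nullary using (Dec; does; yes; no; contradiction; ¬?)
open import Relation.Nullary.Decidable using (dec⇒maybe; dec-true; dec-false; decidable-stable; _×-dec_)
open import Tactic.RingSolver using (solve-∀)
open import Tactic.RingSolver.Core.AlmostCommutativeRing using (AlmostCommutativeRing; fromCommutativeRing)
open ≡-Reasoning

-- The polyhedron Q may have no vertex, so the argument works only with the set of constraints tight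
-- at y. The smallest face through y contains an integer point because `P₁` is the convex hull of
-- its integer points: a convex combination maximises a functional only if every point of positive
-- weight does. Adding to that point a vector of the span of the face keeps the tight constraints
-- equalities but may violate others, which is why y′ can fall outside Q. The same y′ serves both
-- polyhedra, since x - y′ = z₂ + u₂ differs from z₂ by a vector of the second span. Unimodularity
-- enters in the splitting: coordinates in a basis of columns are in general only rational. Each
-- restart has strictly fewer constraints that are not tight, so their number bounds the process;
-- order and equality on ℚ are decidable, so every case distinction is effective.

-- Finite sums in a commutative ring.

module FinSum {A : Set} {_+_ _*_ : Op₂ A} {neg : Op₁ A} {0# 1# : A}
  (isCommutativeRing : IsCommutativeRing _≡_ _+_ _*_ neg 0# 1#)
  -- `Σℤ` and `Σℚ` are separate recursive functions; taking the sum and its two equations as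
  -- parameters covers both, with `refl` for the equations.
  (Σ : ∀ k → (Fin k → A) → A)
  (Σ-zero : ∀ f → Σ 0 f ≡ 0#)
  (Σ-suc : ∀ k f → Σ (suc k) f ≡ (f zero + Σ k (f ∘ suc))) where

  open IsCommutativeRing isCommutativeRing using (+-identityˡ; +-assoc; +-comm; zeroʳ; distribˡ)

  Σ-cong : ∀ k {f g} → (∀ j → f j ≡ g j) → Σ k f ≡ Σ k g
  Σ-cong zero    f≗g = trans (Σ-zero _) (sym (Σ-zero _))
  Σ-cong (suc k) f≗g = trans (Σ-suc k _)
    (trans (cong₂ _+_ (f≗g zero) (Σ-cong k (f≗g ∘ suc))) (sym (Σ-suc k _)))

  Σ-0 : ∀ k {f} → (∀ j → f j ≡ 0#) → Σ k f ≡ 0#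
  Σ-0 zero    f≗0 = Σ-zero _
  Σ-0 (suc k) f≗0 = trans (Σ-suc k _)
    (trans (cong₂ _+_ (f≗0 zero) (Σ-0 k (f≗0 ∘ suc))) (+-identityˡ 0#))

  +-interchange : ∀ a b c d → ((a + b) + (c + d)) ≡ ((a + c) + (b + d))
  +-interchange a b c d = begin
    (a + b) + (c + d)  ≡⟨ +-assoc a b (c + d) ⟩
    a + (b + (c + d))  ≡⟨ cong (a +_) (sym (+-assoc b c d)) ⟩
    a + ((b + c) + d)  ≡⟨ cong (λ e → a + (e + d)) (+-comm b c) ⟩
    a + ((c + b) + d)  ≡⟨ cong (a +_) (+-assoc c b d) ⟩
    a + (c + (b + d))  ≡⟨ sym (+-assoc a c (b + d)) ⟩
    (a + c) + (b + d)  ∎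

  Σ-+ : ∀ k f g → Σ k (λ j → f j + g j) ≡ (Σ k f + Σ k g)
  Σ-+ zero    f g = trans (Σ-zero _)
    (sym (trans (cong₂ _+_ (Σ-zero f) (Σ-zero g)) (+-identityˡ 0#)))
  Σ-+ (suc k) f g = begin
    Σ (suc k) (λ j → f j + g j)
      ≡⟨ Σ-suc k _ ⟩
    (f zero + g zero) + Σ k (λ j → f (suc j) + g (suc j))
      ≡⟨ cong ((f zero + g zero) +_) (Σ-+ k (f ∘ suc) (g ∘ suc)) ⟩
    (f zero + g zero) + (Σ k (f ∘ suc) + Σ k (g ∘ suc))
      ≡⟨ +-interchange _ _ _ _ ⟩
    (f zero + Σ k (f ∘ suc)) + (g zero + Σ k (g ∘ suc))
      ≡⟨ sym (cong₂ _+_ (Σ-suc k f) (Σ-suc k g)) ⟩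
    Σ (suc k) f + Σ (suc k) g ∎

  Σ-* : ∀ k c f → Σ k (λ j → c * f j) ≡ (c * Σ k f)
  Σ-* zero    c f = trans (Σ-zero _) (sym (trans (cong (c *_) (Σ-zero f)) (zeroʳ c)))
  Σ-* (suc k) c f = begin
    Σ (suc k) (λ j → c * f j)               ≡⟨ Σ-suc k _ ⟩
    (c * f zero) + Σ k (λ j → c * f (suc j)) ≡⟨ cong ((c * f zero) +_) (Σ-* k c (f ∘ suc)) ⟩
    (c * f zero) + (c * Σ k (f ∘ suc))       ≡⟨ sym (distribˡ c _ _) ⟩
    c * (f zero + Σ k (f ∘ suc))             ≡⟨ cong (c *_) (sym (Σ-suc k f)) ⟩
    c * Σ (suc k) f                          ∎

  Σ-swap : ∀ k l (f : Fin k → Fin l → A) →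
           Σ k (λ i → Σ l (f i)) ≡ Σ l (λ j → Σ k (λ i → f i j))
  Σ-swap zero    l f = trans (Σ-zero _) (sym (Σ-0 l (λ j → Σ-zero _)))
  Σ-swap (suc k) l f = begin
    Σ (suc k) (λ i → Σ l (f i))
      ≡⟨ Σ-suc k _ ⟩
    Σ l (f zero) + Σ k (λ i → Σ l (f (suc i)))
      ≡⟨ cong (Σ l (f zero) +_) (Σ-swap k l (f ∘ suc)) ⟩
    Σ l (f zero) + Σ l (λ j → Σ k (λ i → f (suc i) j))
      ≡⟨ sym (Σ-+ l _ _) ⟩
    Σ l (λ j → f zero j + Σ k (λ i → f (suc i) j))
      ≡⟨ Σ-cong l (λ j → sym (Σ-suc k _)) ⟩
    Σ l (λ j → Σ (suc k) (λ i → f i j)) ∎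

module Σℤ = FinSum ℤ.+-*-isCommutativeRing Σℤ (λ _ → refl) (λ _ _ → refl)

-- Determinants: alternation, Cramer's relation, cofactors.

module Determinant where

  open import Data.Integer using (+_; -_; _+_; _*_)

  det-cong : ∀ k {M N : Matrix k k} → (∀ i j → M i j ≡ N i j) → det k M ≡ det k N
  det-cong zero    M≗N = refl
  det-cong (suc k) M≗N = Σℤ.Σ-cong (suc k) λ j → cong (altSign j *_)
    (cong₂ _*_ (M≗N zero j) (det-cong k (λ i l → M≗N (suc i) (punchIn j l))))

  -- The expansion of a determinant along its first two rows a and b; D is the
  -- complementary minor as a function of the selected columns.
  expand₂ : ∀ k (a b : Fin (suc (suc k)) → ℤ) → ((Fin k → Fin (suc (suc k))) → ℤ) → ℤ
  expand₂ k a b D = Σℤ (suc (suc k)) λ j → altSign j * (a j *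
    Σℤ (suc k) λ l → altSign l * (b (punchIn j l) * D (punchIn j ∘ punchIn l)))

  private
    regroup : ∀ x y r s → (x + (- y + r)) + (y + (- x + s)) ≡ r + s
    regroup = ℤ-Solver.solve-∀

    rearrange : ∀ s a b d t → - s * (a * (+ 1 * (b * d) + - + 1 * t)) ≡
                - b * (s * (a * d)) + s * (a * t)
    rearrange = ℤ-Solver.solve-∀

    vanish : ∀ x → + 1 * (x * + 0) + + 0 ≡ + 0
    vanish = ℤ-Solver.solve-∀

    neg-out : ∀ s e → - s * e ≡ - + 1 * (s * e)
    neg-out = ℤ-Solver.solve-∀

  -- Different compositions of `punchIn` select the same columns but are equal only pointwise, so a
  -- function of selections has to respect pointwise equality.
  Ext : ∀ {k l} → ((Fin k → Fin l) → ℤ) → Set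
  Ext D = ∀ τ τ′ → (∀ i → τ i ≡ τ′ i) → D τ ≡ D τ′

  module _ {k} (D : (Fin k → Fin (suc (suc k))) → ℤ) where

    throughColumn₀ : (a b : Fin (suc (suc k)) → ℤ) → ℤ
    throughColumn₀ a b = a zero * Σℤ (suc k) λ l → altSign l * (b (suc l) * D (suc ∘ punchIn l))

    avoidingColumn₀′ : (b : Fin (suc (suc k)) → ℤ) → Fin (suc k) → ℤ
    avoidingColumn₀′ b j = Σℤ k λ l → altSign l *
      (b (suc (punchIn j l)) * D (punchIn (suc j) ∘ punchIn (suc l)))

    avoidingColumn₀ : (a b : Fin (suc (suc k)) → ℤ) → ℤ
    avoidingColumn₀ a b = Σℤ (suc k) λ j → altSign j * (a (suc j) * avoidingColumn₀′ b j)

    -- If the second row uses column 0, the first uses some column `suc j` with sign `- altSign j`,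
    -- while column 0 comes first among the remaining ones and has sign +1. This is `throughColumn₀`
    -- with the rows exchanged and the sign reversed.
    expand₂-split : Ext D → ∀ a b → expand₂ k a b D ≡
      throughColumn₀ a b + (- throughColumn₀ b a + avoidingColumn₀ a b)
    expand₂-split D-cong a b = cong₂ _+_ (ℤ.*-identityˡ (throughColumn₀ a b)) (begin
      (Σℤ (suc k) λ j → - altSign j * (a (suc j) *
         (+ 1 * (b zero * D (punchIn (suc j) ∘ punchIn zero)) +
           Σℤ k λ l → - altSign l * (b (suc (punchIn j l)) * D (punchIn (suc j) ∘ punchIn (suc l))))))
        ≡⟨ Σℤ.Σ-cong (suc k) (λ j → cong (λ e → - altSign j * (a (suc j) * e))
             (cong₂ _+_ (cong (λ e → + 1 * (b zero * e))
               (D-cong (punchIn (suc j) ∘ punchIn zero) (suc ∘ punchIn j) (λ _ → refl)))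
               (trans (Σℤ.Σ-cong k (λ l → neg-out (altSign l) (summand j l)))
                 (Σℤ.Σ-* k (- + 1) (λ l → altSign l * summand j l))))) ⟩
      (Σℤ (suc k) λ j → - altSign j * (a (suc j) *
         (+ 1 * (b zero * D (suc ∘ punchIn j)) + - + 1 * avoidingColumn₀′ b j)))
        ≡⟨ Σℤ.Σ-cong (suc k) (λ j → rearrange (altSign j) (a (suc j)) (b zero)
             (D (suc ∘ punchIn j)) (avoidingColumn₀′ b j)) ⟩
      (Σℤ (suc k) λ j → - b zero * (altSign j * (a (suc j) * D (suc ∘ punchIn j))) +
         altSign j * (a (suc j) * avoidingColumn₀′ b j))
        ≡⟨ Σℤ.Σ-+ (suc k)
             (λ j → - b zero * (altSign j * (a (suc j) * D (suc ∘ punchIn j))))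
             (λ j → altSign j * (a (suc j) * avoidingColumn₀′ b j)) ⟩
      (Σℤ (suc k) λ j → - b zero * (altSign j * (a (suc j) * D (suc ∘ punchIn j)))) +
        avoidingColumn₀ a b
        ≡⟨ cong (_+ avoidingColumn₀ a b) (trans
             (Σℤ.Σ-* (suc k) (- b zero) (λ j → altSign j * (a (suc j) * D (suc ∘ punchIn j))))
             (sym (ℤ.neg-distribˡ-* (b zero) _))) ⟩
      - throughColumn₀ b a + avoidingColumn₀ a b ∎)
      where
      summand : Fin (suc k) → Fin k → ℤ
      summand j l = b (suc (punchIn j l)) * D (punchIn (suc j) ∘ punchIn (suc l))

  lift : ∀ {p q} → (Fin p → Fin q) → Fin (suc p) → Fin (suc q)
  lift τ zero    = zero
  lift τ (suc i) = suc (τ i)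

  lift-cong : ∀ {p q} {τ τ′ : Fin p → Fin q} → (∀ i → τ i ≡ τ′ i) → ∀ i → lift τ i ≡ lift τ′ i
  lift-cong τ≗τ′ zero    = refl
  lift-cong τ≗τ′ (suc i) = cong suc (τ≗τ′ i)

  -- When neither removed column is column 0, that column stays first in the complementary minor.
  -- Fixing it there by `lift` leaves a two-row expansion with one column fewer.
  avoidingColumn₀-suc : ∀ {k} D → Ext D → ∀ a b →
    avoidingColumn₀ {suc k} D a b ≡ expand₂ k (a ∘ suc) (b ∘ suc) (D ∘ lift)
  avoidingColumn₀-suc {k} D D-cong a b =
    Σℤ.Σ-cong (suc (suc k)) λ j → cong (λ e → altSign j * (a (suc j) * e))
      (Σℤ.Σ-cong (suc k) λ l → cong (λ e → altSign l * (b (suc (punchIn j l)) * e))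
        (D-cong (punchIn (suc j) ∘ punchIn (suc l)) (lift (punchIn j ∘ punchIn l))
          λ { zero → refl ; (suc i) → refl }))

  -- The pairs of columns (0 , l) and (l , 0) cancel against the corresponding
  -- pairs with a and b exchanged; the other pairs avoid column 0.
  expand₂-antisym : ∀ k a b D → Ext D → expand₂ k a b D + expand₂ k b a D ≡ + 0
  avoidingColumn₀-antisym : ∀ k a b D → Ext D →
    avoidingColumn₀ {k} D a b + avoidingColumn₀ D b a ≡ + 0

  expand₂-antisym k a b D D-cong = begin
    expand₂ k a b D + expand₂ k b a D
      ≡⟨ cong₂ _+_ (expand₂-split D D-cong a b) (expand₂-split D D-cong b a) ⟩
    (throughColumn₀ D a b + (- throughColumn₀ D b a + avoidingColumn₀ D a b)) +
      (throughColumn₀ D b a + (- throughColumn₀ D a b + avoidingColumn₀ D b a))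
      ≡⟨ regroup (throughColumn₀ D a b) (throughColumn₀ D b a) _ _ ⟩
    avoidingColumn₀ D a b + avoidingColumn₀ D b a
      ≡⟨ avoidingColumn₀-antisym k a b D D-cong ⟩
    + 0 ∎

  avoidingColumn₀-antisym zero a b D D-cong = cong₂ _+_ (vanish (a (suc zero))) (vanish (b (suc zero)))
  avoidingColumn₀-antisym (suc k) a b D D-cong =
    trans (cong₂ _+_ (avoidingColumn₀-suc D D-cong a b) (avoidingColumn₀-suc D D-cong b a))
      (expand₂-antisym k (a ∘ suc) (b ∘ suc) (D ∘ lift) (λ τ τ′ τ≗τ′ → D-cong (lift τ) (lift τ′) (lift-cong τ≗τ′)))

  swapRows : ∀ {n m} → Matrix (suc (suc n)) m → Matrix (suc (suc n)) m
  swapRows M zero          = M (suc zero)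
  swapRows M (suc zero)    = M zero
  swapRows M (suc (suc i)) = M (suc (suc i))

  det-swapRows : ∀ k (M : Matrix (suc (suc k)) (suc (suc k))) →
                 det (suc (suc k)) M + det (suc (suc k)) (swapRows M) ≡ + 0
  det-swapRows k M = expand₂-antisym k (M zero) (M (suc zero))
    (λ τ → det k (λ i l → M (suc (suc i)) (τ l)))
    (λ τ τ′ τ≗τ′ → det-cong k (λ i l → cong (M (suc (suc i))) (τ≗τ′ l)))

  i+i≡0⇒i≡0 : ∀ i → i + i ≡ + 0 → i ≡ + 0
  i+i≡0⇒i≡0 (+ zero) _ = refl

  -- Exchanging the first two rows moves the repeated row away from the first
  -- position, and expanding along the new first row repeats it in every minor.
  det-repeatedRow : ∀ k (M : Matrix (suc k) (suc k)) i → (∀ l → M zero l ≡ M (suc i) l) →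
                    det (suc k) M ≡ + 0
  -- Exchanging two equal rows changes nothing, so the determinant is its own negative, and ℤ has no
  -- 2-torsion.
  det-repeatedRow (suc k) M zero M₀≗M₁ = i+i≡0⇒i≡0 _
    (trans (cong (λ e → det (suc (suc k)) M + e) (det-cong (suc (suc k)) swap-invariant))
      (det-swapRows k M))
    where
    swap-invariant : ∀ i j → M i j ≡ swapRows M i j
    swap-invariant zero          j = M₀≗M₁ j
    swap-invariant (suc zero)    j = sym (M₀≗M₁ j)
    swap-invariant (suc (suc i)) j = refl
  det-repeatedRow (suc k) M (suc i) M₀≗Mᵢ = begin
    det (suc (suc k)) M
      ≡⟨ sym (ℤ.+-identityʳ _) ⟩
    det (suc (suc k)) M + + 0
      ≡⟨ cong (λ e → det (suc (suc k)) M + e) (sym swapped≡0) ⟩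
    det (suc (suc k)) M + det (suc (suc k)) (swapRows M)
      ≡⟨ det-swapRows k M ⟩
    + 0 ∎
    where
    swapped≡0 : det (suc (suc k)) (swapRows M) ≡ + 0
    swapped≡0 = Σℤ.Σ-0 (suc (suc k)) λ j →
      trans (cong (λ e → altSign j * (M (suc zero) j * e))
              (det-repeatedRow k (λ r l → swapRows M (suc r) (punchIn j l)) i
                (λ l → M₀≗Mᵢ (punchIn j l))))
        (trans (cong (altSign j *_) (ℤ.*-zeroʳ (M (suc zero) j))) (ℤ.*-zeroʳ (altSign j)))

  -- The left side is the expansion, along its top row, of `M` bordered by a second copy of row `i`.
  cramer : ∀ n (M : Matrix n (suc n)) i →
           Σℤ (suc n) (λ j → altSign j * (M i j * det n (λ r l → M r (punchIn j l)))) ≡ + 0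
  cramer n M i = det-repeatedRow n bordered i (λ _ → refl)
    where
    bordered : Matrix (suc n) (suc n)
    bordered zero    = M i
    bordered (suc r) = M r

  infixr 5 _◃_

  _◃_ : ∀ {n m} → (Fin n → ℤ) → Matrix n m → Matrix n (suc m)
  (v ◃ M) i zero    = v i
  (v ◃ M) i (suc j) = M i j

  ◃-suc : ∀ {n m} v (M : Matrix (suc n) m) i l → (v ◃ M) (suc i) l ≡ (v ∘ suc ◃ M ∘ suc) i l
  ◃-suc v M i zero    = refl
  ◃-suc v M i (suc l) = refl

  ◃-punchIn : ∀ {n m} v (M : Matrix n (suc m)) k i l →
              (v ◃ M) i (punchIn (suc k) l) ≡ (v ◃ (λ r → M r ∘ punchIn k)) i l
  ◃-punchIn v M k i zero    = refl
  ◃-punchIn v M k i (suc l) = refl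

  -- The signed coefficient of `v i` in `det (v ◃ M)`. It is computed by expanding along the top
  -- row, because `det` expands along rows and the adjoined entries form a column.
  cofactor : ∀ k → Matrix (suc k) k → Fin (suc k) → ℤ
  cofactor k       M zero    = det k (M ∘ suc)
  cofactor (suc k) M (suc i) =
    Σℤ (suc k) λ l → - altSign l * (M zero l * cofactor k (λ r → M (suc r) ∘ punchIn l) i)

  det-◃ : ∀ k (M : Matrix (suc k) k) v →
          det (suc k) (v ◃ M) ≡ Σℤ (suc k) (λ i → cofactor k M i * v i)
  det-◃ zero    M v = cong (_+ + 0) (trans (ℤ.*-identityˡ _) (ℤ.*-comm (v zero) (+ 1)))
  det-◃ (suc k) M v = cong₂ _+_
    (trans (ℤ.*-identityˡ _) (ℤ.*-comm (v zero) _))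
    (begin
      (Σℤ (suc k) λ l → - altSign l * (M zero l *
         det (suc k) (λ r l′ → (v ◃ M) (suc r) (punchIn (suc l) l′))))
        ≡⟨ Σℤ.Σ-cong (suc k) (λ l → cong (λ e → - altSign l * (M zero l * e))
             (trans (det-cong (suc k) (λ r → ◃-punchIn v M l (suc r)))
               (trans (det-cong (suc k) (◃-suc v (λ r → M r ∘ punchIn l))) (det-◃ k (N l) (v ∘ suc))))) ⟩
      (Σℤ (suc k) λ l → - altSign l * (M zero l *
         Σℤ (suc k) λ i → cofactor k (N l) i * v (suc i)))
        ≡⟨ Σℤ.Σ-cong (suc k) (λ l → trans
             (cong (- altSign l *_) (sym (Σℤ.Σ-* (suc k) (M zero l)
               (λ i → cofactor k (N l) i * v (suc i)))))
             (sym (Σℤ.Σ-* (suc k) (- altSign l)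
               (λ i → M zero l * (cofactor k (N l) i * v (suc i)))))) ⟩
      (Σℤ (suc k) λ l → Σℤ (suc k) λ i →
         - altSign l * (M zero l * (cofactor k (N l) i * v (suc i))))
        ≡⟨ Σℤ.Σ-swap (suc k) (suc k)
             (λ l i → - altSign l * (M zero l * (cofactor k (N l) i * v (suc i)))) ⟩
      (Σℤ (suc k) λ i → Σℤ (suc k) λ l →
         - altSign l * (M zero l * (cofactor k (N l) i * v (suc i))))
        ≡⟨ Σℤ.Σ-cong (suc k) (λ i → trans
             (Σℤ.Σ-cong (suc k) (λ l → pull (- altSign l) (M zero l) (cofactor k (N l) i) (v (suc i))))
             (trans (Σℤ.Σ-* (suc k) (v (suc i)) (λ l → - altSign l * (M zero l * cofactor k (N l) i)))
               (ℤ.*-comm (v (suc i)) _))) ⟩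
      (Σℤ (suc k) λ i → cofactor (suc k) M (suc i) * v (suc i)) ∎)
    where
    N : Fin (suc k) → Matrix (suc k) k
    N l r = M (suc r) ∘ punchIn l

    pull : ∀ s m c w → s * (m * (c * w)) ≡ w * (s * (m * c))
    pull = ℤ-Solver.solve-∀

open Determinant using (det-cong; cramer; _◃_; ◃-punchIn; cofactor; det-◃)

-- The embedding of ℤ into ℚ.

open import Data.Rational using (_+_; _*_; _-_; -_; _≤_; _<_)

ℚ-ring : AlmostCommutativeRing 0ℓ 0ℓ
ℚ-ring = fromCommutativeRing ℚ.+-*-commutativeRing (λ p → dec⇒maybe (0ℚ ℚ.≟ p))

*-exchange : ∀ p q r → p * (q * r) ≡ q * (p * r)
*-exchange = solve-∀ ℚ-ring

module Σℚ = FinSum ℚ.+-*-isCommutativeRing Σℚ (λ _ → refl) (λ _ _ → refl)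

-- Addition on ℚ reduces fractions; passing to unnormalised fractions leaves an identity between
-- numerators over the denominator 1.
toℚ-+ : ∀ a b → toℚ (a ℤ.+ b) ≡ toℚ a + toℚ b
toℚ-+ a b = ℚ.toℚᵘ-injective (ℚᵘ.≃-trans (ℚ.toℚᵘ-fromℚᵘ (ℚᵘ.mkℚᵘ (a ℤ.+ b) 0))
  (ℚᵘ.≃-trans (ℚᵘ.*≡* (numerators a b))
    (ℚᵘ.≃-sym (ℚᵘ.≃-trans (ℚ.toℚᵘ-homo-+ (toℚ a) (toℚ b))
      (ℚᵘ.+-cong (ℚ.toℚᵘ-fromℚᵘ (ℚᵘ.mkℚᵘ a 0)) (ℚ.toℚᵘ-fromℚᵘ (ℚᵘ.mkℚᵘ b 0)))))))
  where
  numerators : ∀ a b → (a ℤ.+ b) ℤ.* ℤ.+ 1 ≡ (a ℤ.* ℤ.+ 1 ℤ.+ b ℤ.* ℤ.+ 1) ℤ.* ℤ.+ 1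
  numerators = ℤ-Solver.solve-∀

toℚ-* : ∀ a b → toℚ (a ℤ.* b) ≡ toℚ a * toℚ b
toℚ-* a b = ℚ.toℚᵘ-injective (ℚᵘ.≃-trans (ℚ.toℚᵘ-fromℚᵘ (ℚᵘ.mkℚᵘ (a ℤ.* b) 0))
  (ℚᵘ.≃-sym (ℚᵘ.≃-trans (ℚ.toℚᵘ-homo-* (toℚ a) (toℚ b))
    (ℚᵘ.*-cong (ℚ.toℚᵘ-fromℚᵘ (ℚᵘ.mkℚᵘ a 0)) (ℚ.toℚᵘ-fromℚᵘ (ℚᵘ.mkℚᵘ b 0))))))

toℚ-neg : ∀ a → toℚ (ℤ.- a) ≡ - toℚ a
toℚ-neg a = begin
  toℚ (ℤ.- a)                         ≡⟨ cancel (toℚ (ℤ.- a)) (toℚ a) ⟩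
  (toℚ (ℤ.- a) + toℚ a) - toℚ a       ≡⟨ cong (_- toℚ a) (sym (toℚ-+ (ℤ.- a) a)) ⟩
  toℚ (ℤ.- a ℤ.+ a) - toℚ a           ≡⟨ cong (λ e → toℚ e - toℚ a) (ℤ.+-inverseˡ a) ⟩
  0ℚ - toℚ a                          ≡⟨ ℚ.+-identityˡ _ ⟩
  - toℚ a                             ∎
  where
  cancel : ∀ x y → x ≡ (x + y) - y
  cancel = solve-∀ ℚ-ring

toℚ-injective : ∀ {a b} → toℚ a ≡ toℚ b → a ≡ b
toℚ-injective {a} {b} eq
  with ℚᵘ.*≡* a*1≡b*1 ← ℚ.fromℚᵘ-injective {ℚᵘ.mkℚᵘ a 0} {ℚᵘ.mkℚᵘ b 0} eq =
  trans (sym (ℤ.*-identityʳ a)) (trans a*1≡b*1 (ℤ.*-identityʳ b))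

toℚ-Σ : ∀ k f → toℚ (Σℤ k f) ≡ Σℚ k (toℚ ∘ f)
toℚ-Σ zero    f = refl
toℚ-Σ (suc k) f = trans (toℚ-+ (f zero) _) (cong (toℚ (f zero) +_) (toℚ-Σ k (f ∘ suc)))

-- Spans of sets of columns.

module _ {n m} (A : Matrix n m) (T : Fin m → Bool) where

  colSpan-resp : ∀ {u v} → (∀ i → v i ≡ u i) → ColSpan A T u → ColSpan A T v
  colSpan-resp v≗u (c , off , u≡) = c , off , λ i → trans (v≗u i) (u≡ i)

  colSpan-0 : ColSpan A T (λ _ → 0ℚ)
  colSpan-0 = (λ _ → 0ℚ) , (λ _ _ → refl) , λ i → sym (Σℚ.Σ-0 m (λ j → ℚ.*-zeroˡ (toℚ (A i j))))

  colSpan-+ : ∀ {u v} → ColSpan A T u → ColSpan A T v → ColSpan A T (λ i → u i + v i)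
  colSpan-+ (c , c-off , u≡) (d , d-off , v≡) =
    (λ j → c j + d j) ,
    (λ j j∉T → trans (cong₂ _+_ (c-off j j∉T) (d-off j j∉T)) (ℚ.+-identityˡ 0ℚ)) ,
    λ i → trans (cong₂ _+_ (u≡ i) (v≡ i)) (trans
      (sym (Σℚ.Σ-+ m (λ j → c j * toℚ (A i j)) (λ j → d j * toℚ (A i j))))
      (Σℚ.Σ-cong m (λ j → sym (ℚ.*-distribʳ-+ (toℚ (A i j)) (c j) (d j)))))

  colSpan-* : ∀ l {u} → ColSpan A T u → ColSpan A T (λ i → l * u i)
  colSpan-* l (c , c-off , u≡) =
    (λ j → l * c j) ,
    (λ j j∉T → trans (cong (l *_) (c-off j j∉T)) (ℚ.*-zeroʳ l)) ,
    λ i → trans (cong (l *_) (u≡ i)) (trans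
      (sym (Σℚ.Σ-* m l (λ j → c j * toℚ (A i j))))
      (Σℚ.Σ-cong m (λ j → sym (ℚ.*-assoc l (c j) (toℚ (A i j))))))

  colSpan-mono : ∀ T′ {u} → (∀ j → T′ j ≡ false → T j ≡ false) → ColSpan A T u → ColSpan A T′ u
  colSpan-mono T′ T⊆T′ (c , c-off , u≡) = c , (λ j j∉T′ → c-off j (T⊆T′ j j∉T′)) , u≡

δ : ∀ {m} → Fin m → Fin m → ℚ
δ zero    zero    = 1ℚ
δ zero    (suc j) = 0ℚ
δ (suc i) zero    = 0ℚ
δ (suc i) (suc j) = δ i j

δ-off : ∀ {m} {i j : Fin m} → i ≢ j → δ i j ≡ 0ℚ
δ-off {i = zero}  {zero}  i≢j = contradiction refl i≢j
δ-off {i = zero}  {suc j} i≢j = refl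
δ-off {i = suc i} {zero}  i≢j = refl
δ-off {i = suc i} {suc j} i≢j = δ-off (i≢j ∘ cong suc)

Σ-δ : ∀ m i (f : Fin m → ℚ) → Σℚ m (λ j → δ i j * f j) ≡ f i
Σ-δ (suc m) zero    f = trans
  (cong₂ _+_ (ℚ.*-identityˡ (f zero)) (Σℚ.Σ-0 m (λ j → ℚ.*-zeroˡ (f (suc j)))))
  (ℚ.+-identityʳ (f zero))
Σ-δ (suc m) (suc i) f = trans
  (cong₂ _+_ (ℚ.*-zeroˡ (f zero)) (Σ-δ m i (f ∘ suc)))
  (ℚ.+-identityˡ (f (suc i)))

colSpan-column : ∀ {n m} (A : Matrix n m) T j → T j ≡ true → ColSpan A T (λ i → toℚ (A i j))
colSpan-column {m = m} A T j j∈T =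
  δ j ,
  (λ l l∉T → δ-off {i = j} {l} λ { refl → contradiction (trans (sym j∈T) l∉T) λ () }) ,
  λ i → sym (Σ-δ m j (λ l → toℚ (A i l)))

-- `σ` may repeat a column, so the coefficient of a column of `A` is not a single `γ l`; adding the
-- summands one by one accumulates it.
colSpan-Σ : ∀ {n m} (A : Matrix n m) T k (σ : Fin k → Fin m) (γ : Fin k → ℤ) →
            (∀ l → T (σ l) ≡ false → γ l ≡ ℤ.+ 0) →
            ColSpan A T (λ i → toℚ (Σℤ k (λ l → γ l ℤ.* A i (σ l))))
colSpan-Σ A T zero    σ γ γ-off = colSpan-0 A T
colSpan-Σ A T (suc k) σ γ γ-off = colSpan-resp A T
  (λ i → toℚ-+ (γ zero ℤ.* A i (σ zero)) _)
  (colSpan-+ A T head (colSpan-Σ A T k (σ ∘ suc) (γ ∘ suc) (γ-off ∘ suc)))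
  where
  head : ColSpan A T (λ i → toℚ (γ zero ℤ.* A i (σ zero)))
  head with T (σ zero) in eq
  ... | true  = colSpan-resp A T (λ i → toℚ-* (γ zero) (A i (σ zero)))
                  (colSpan-* A T (toℚ (γ zero)) (colSpan-column A T (σ zero) eq))
  ... | false = colSpan-resp A T
                  (λ i → cong toℚ (trans (cong (ℤ._* A i (σ zero)) (γ-off zero eq))
                    (ℤ.*-zeroˡ (A i (σ zero)))))
                  (colSpan-0 A T)

-- Nonzero minors and bases of columns.

columns : ∀ {n m k} → Matrix n m → (Fin k → Fin m) → Matrix n k
columns A σ i = A i ∘ σ

minor-∷ : ∀ {n m} (A : Matrix (suc n) m) j σ →
          minor A (j ∷ σ) ≡ det (suc n) ((λ i → A i j) ◃ columns A σ)
minor-∷ {n} A j σ = det-cong (suc n)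
  {λ i k → A i ((j ∷ σ) k)} {(λ i → A i j) ◃ columns A σ}
  λ { i zero → refl ; i (suc k) → refl }

toℚ-det-◃ : ∀ k (M : Matrix (suc k) k) v → toℚ (det (suc k) (v ◃ M)) ≡
            Σℚ (suc k) (λ i → toℚ (cofactor k M i) * toℚ (v i))
toℚ-det-◃ k M v = trans (cong toℚ (det-◃ k M v))
  (trans (toℚ-Σ (suc k) (λ i → cofactor k M i ℤ.* v i))
    (Σℚ.Σ-cong (suc k) (λ i → toℚ-* (cofactor k M i) (v i))))

-- If no column extends a nonzero minor of the last rows, the cofactors of the
-- new first column are a linear relation between the rows.
nonzeroMinor : ∀ n m (A : Matrix n m) → RankFull A → ∃ λ σ → minor A σ ≢ ℤ.+ 0
nonzeroMinor zero    m A rank = (λ ()) , λ ()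
nonzeroMinor (suc n) m A rank with nonzeroMinor n m (A ∘ suc) tail-rank
  where
  tail-rank : RankFull (A ∘ suc)
  tail-rank y yA≡0 i = rank (0ℚ ∷ y)
    (λ j → trans (cong₂ _+_ (ℚ.*-zeroˡ (toℚ (A zero j))) (yA≡0 j)) (ℚ.+-identityˡ 0ℚ)) (suc i)
... | σ , σ≢0 with any? (λ j → ¬? (minor A (j ∷ σ) ℤ.≟ ℤ.+ 0))
...   | yes (j , j∷σ≢0) = j ∷ σ , j∷σ≢0
-- The coefficient of the top row in this relation is the minor of `σ` itself, which full rank would
-- force to be 0.
...   | no none = contradiction
        (toℚ-injective (rank (toℚ ∘ cofactor n (columns A σ)) relation zero)) σ≢0
  where
  relation : ∀ j → Σℚ (suc n) (λ i → toℚ (cofactor n (columns A σ) i) * toℚ (A i j)) ≡ 0ℚ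
  relation j = begin
    Σℚ (suc n) (λ i → toℚ (cofactor n (columns A σ) i) * toℚ (A i j))
      ≡⟨ sym (toℚ-det-◃ n (columns A σ) (λ i → A i j)) ⟩
    toℚ (det (suc n) ((λ i → A i j) ◃ columns A σ))
      ≡⟨ cong toℚ (sym (minor-∷ A j σ)) ⟩
    toℚ (minor A (j ∷ σ))
      ≡⟨ cong toℚ (decidable-stable (minor A (j ∷ σ) ℤ.≟ ℤ.+ 0) (λ ≢0 → none (j , ≢0))) ⟩
    0ℚ ∎

-- Serves twice as a termination measure: for the basis columns outside `T`, and for the constraints
-- that are not tight.
countFalse : ∀ {n} → (Fin n → Bool) → ℕ
countFalse {zero}  p = 0
countFalse {suc n} p = (if p zero then 0 else 1) ℕ.+ countFalse (p ∘ suc)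

countFalse-punchIn : ∀ {n} (p : Fin (suc n) → Bool) k → p k ≡ false →
                     countFalse p ≡ suc (countFalse (p ∘ punchIn k))
countFalse-punchIn p zero pk≡false rewrite pk≡false = refl
countFalse-punchIn {suc n} p (suc k) pk≡false
  rewrite countFalse-punchIn (p ∘ suc) k pk≡false with p zero
... | true  = refl
... | false = refl

-- By Cramer's rule the last condition says that the columns of T lie in the
-- span of the columns of σ that belong to T.
basisAdaptedTo : ∀ {n m} (A : Matrix (suc n) m) T → RankFull A →
  ∃ λ σ → minor A σ ≢ ℤ.+ 0 ×
    (∀ k j → T (σ k) ≡ false → T j ≡ true → minor A (j ∷ σ ∘ punchIn k) ≡ ℤ.+ 0)
basisAdaptedTo {n} {m} A T rank with σ₀ , σ₀≢0 ← nonzeroMinor (suc n) m A rank =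
  exchange _ σ₀ σ₀≢0 refl
  where
  -- Instead of growing an independent subset of `T`, any basis is improved: each exchange puts a
  -- column of `T` in place of one outside `T`, so the number `N` of the latter drops by one.
  exchange : ∀ N σ → minor A σ ≢ ℤ.+ 0 → countFalse (T ∘ σ) ≡ N →
    ∃ λ σ → minor A σ ≢ ℤ.+ 0 ×
      (∀ k j → T (σ k) ≡ false → T j ≡ true → minor A (j ∷ σ ∘ punchIn k) ≡ ℤ.+ 0)
  exchange N σ σ≢0 count≡N
    with any? (λ k → any? (λ j → T (σ k) Bool.≟ false ×-dec T j Bool.≟ true ×-dec
                ¬? (minor A (j ∷ σ ∘ punchIn k) ℤ.≟ ℤ.+ 0)))
  ... | no none = σ , σ≢0 , λ k j σk∉T j∈T →
          decidable-stable (minor A (j ∷ σ ∘ punchIn k) ℤ.≟ ℤ.+ 0)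
            (λ ≢0 → none (k , j , σk∉T , j∈T , ≢0))
  exchange zero σ σ≢0 count≡N | yes (k , j , σk∉T , j∈T , ≢0) =
    contradiction (trans (sym (countFalse-punchIn (T ∘ σ) k σk∉T)) count≡N) λ ()
  exchange (suc N) σ σ≢0 count≡N | yes (k , j , σk∉T , j∈T , ≢0) =
    exchange N (j ∷ σ ∘ punchIn k) ≢0 (trans
      (cong (λ b → (if b then 0 else 1) ℕ.+ countFalse (T ∘ σ ∘ punchIn k)) j∈T)
      (ℕ.suc-injective (trans (sym (countFalse-punchIn (T ∘ σ) k σk∉T)) count≡N)))

-- Integral coordinates in a basis of columns.

-- A unit of ℤ is its own inverse, so the division in Cramer's rule becomes a multiplication.
minor-unit : ∀ {n m} (A : Matrix n m) → Unimodular A → ∀ σ → minor A σ ≢ ℤ.+ 0 →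
             minor A σ ℤ.* minor A σ ≡ ℤ.+ 1
minor-unit A (_ , minors) σ σ≢0 with minors σ
... | inj₁ ≡0         = contradiction ≡0 σ≢0
... | inj₂ (inj₁ ≡1)  = cong₂ ℤ._*_ ≡1 ≡1
... | inj₂ (inj₂ ≡-1) = cong₂ ℤ._*_ ≡-1 ≡-1

module _ {n m} (A : Matrix (suc n) m) (σ : Fin (suc n) → Fin m)
  (unit : minor A σ ℤ.* minor A σ ≡ ℤ.+ 1) (u : Fin (suc n) → ℤ) where

  -- Cramer's rule with `u` in place of the basis column `k`. Here `u` stands in front instead of in
  -- position `k`, which accounts for `altSign k`; the factor `minor A σ` is the inverse of the
  -- denominator.
  coordinate : Fin (suc n) → ℤ
  coordinate k = minor A σ ℤ.* (altSign k ℤ.* det (suc n) (u ◃ columns A (σ ∘ punchIn k)))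

  -- `cramer` for the basis with `u` adjoined is a linear relation in which `u` has coefficient `e`;
  -- since `e` squares to 1, it can be solved for `u` over ℤ.
  coordinates-sum : ∀ i → u i ≡ Σℤ (suc n) (λ k → coordinate k ℤ.* A i (σ k))
  coordinates-sum i = begin
    u i              ≡⟨ sym (ℤ.*-identityˡ (u i)) ⟩
    ℤ.+ 1 ℤ.* u i    ≡⟨ cong (ℤ._* u i) (sym unit) ⟩
    e ℤ.* e ℤ.* u i  ≡⟨ isolate e (u i) S ⟩
    e ℤ.* (ℤ.+ 1 ℤ.* (u i ℤ.* e) ℤ.+ (ℤ.- e) ℤ.* S) ℤ.+ e ℤ.* e ℤ.* S
      ≡⟨ cong₂ (λ p q → e ℤ.* p ℤ.+ q ℤ.* S) relation unit ⟩
    e ℤ.* ℤ.+ 0 ℤ.+ ℤ.+ 1 ℤ.* S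
      ≡⟨ simplify e S ⟩
    S ∎
    where
    e S : ℤ
    e = minor A σ
    S = Σℤ (suc n) (λ k → coordinate k ℤ.* A i (σ k))

    d : Fin (suc n) → ℤ
    d k = det (suc n) (u ◃ columns A (σ ∘ punchIn k))

    isolate : ∀ e x s → e ℤ.* e ℤ.* x ≡
      e ℤ.* (ℤ.+ 1 ℤ.* (x ℤ.* e) ℤ.+ (ℤ.- e) ℤ.* s) ℤ.+ e ℤ.* e ℤ.* s
    isolate = ℤ-Solver.solve-∀

    simplify : ∀ e s → e ℤ.* ℤ.+ 0 ℤ.+ ℤ.+ 1 ℤ.* s ≡ s
    simplify = ℤ-Solver.solve-∀

    regroup : ∀ e t d a → (ℤ.- e) ℤ.* ((e ℤ.* (t ℤ.* d)) ℤ.* a) ≡ e ℤ.* e ℤ.* (ℤ.- t ℤ.* (a ℤ.* d))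
    regroup = ℤ-Solver.solve-∀

    relation : ℤ.+ 1 ℤ.* (u i ℤ.* e) ℤ.+ (ℤ.- e) ℤ.* S ≡ ℤ.+ 0
    relation = trans
      (cong (λ s → ℤ.+ 1 ℤ.* (u i ℤ.* e) ℤ.+ s) (trans
        (sym (Σℤ.Σ-* (suc n) (ℤ.- e) (λ k → coordinate k ℤ.* A i (σ k))))
        (Σℤ.Σ-cong (suc n) λ k → begin
          (ℤ.- e) ℤ.* (coordinate k ℤ.* A i (σ k))
            ≡⟨ regroup e (altSign k) (d k) (A i (σ k)) ⟩
          e ℤ.* e ℤ.* (ℤ.- altSign k ℤ.* (A i (σ k) ℤ.* d k))
            ≡⟨ cong (ℤ._* (ℤ.- altSign k ℤ.* (A i (σ k) ℤ.* d k))) unit ⟩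
          ℤ.+ 1 ℤ.* (ℤ.- altSign k ℤ.* (A i (σ k) ℤ.* d k))
            ≡⟨ ℤ.*-identityˡ _ ⟩
          ℤ.- altSign k ℤ.* (A i (σ k) ℤ.* d k)
            ≡⟨ cong (λ x → ℤ.- altSign k ℤ.* (A i (σ k) ℤ.* x))
                 (sym (det-cong (suc n) (◃-punchIn u (columns A σ) k))) ⟩
          ℤ.- altSign k ℤ.* (A i (σ k) ℤ.*
            det (suc n) (λ r l → (u ◃ columns A σ) r (punchIn (suc k) l))) ∎)))
      (cramer (suc n) (u ◃ columns A σ) i)

  -- The determinant is linear in its first column. Writing `u` as a combination of columns of `T`
  -- turns it into a sum of minors that all vanish.
  coordinate-off : ∀ T → ColSpan A T (toℚ ∘ u) → ∀ k →
    (∀ j → T j ≡ true → minor A (j ∷ σ ∘ punchIn k) ≡ ℤ.+ 0) → coordinate k ≡ ℤ.+ 0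
  coordinate-off T (c , c-off , u≡) k vanish = begin
    minor A σ ℤ.* (altSign k ℤ.* det (suc n) (u ◃ N))
      ≡⟨ cong (λ e → minor A σ ℤ.* (altSign k ℤ.* e)) (toℚ-injective det≡0) ⟩
    minor A σ ℤ.* (altSign k ℤ.* ℤ.+ 0)
      ≡⟨ cong (minor A σ ℤ.*_) (ℤ.*-zeroʳ (altSign k)) ⟩
    minor A σ ℤ.* ℤ.+ 0
      ≡⟨ ℤ.*-zeroʳ (minor A σ) ⟩
    ℤ.+ 0 ∎
    where
    N : Matrix (suc n) n
    N = columns A (σ ∘ punchIn k)

    y : Fin (suc n) → ℚ
    y i = toℚ (cofactor n N i)

    term≡0 : ∀ j → c j * toℚ (det (suc n) ((λ i → A i j) ◃ N)) ≡ 0ℚ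
    term≡0 j with T j in eq
    ... | true  = trans (cong (λ e → c j * toℚ e)
                    (trans (sym (minor-∷ A j (σ ∘ punchIn k))) (vanish j eq))) (ℚ.*-zeroʳ (c j))
    ... | false = trans (cong (_* toℚ (det (suc n) ((λ i → A i j) ◃ N))) (c-off j eq))
                    (ℚ.*-zeroˡ (toℚ (det (suc n) ((λ i → A i j) ◃ N))))

    det≡0 : toℚ (det (suc n) (u ◃ N)) ≡ toℚ (ℤ.+ 0)
    det≡0 = begin
      toℚ (det (suc n) (u ◃ N))
        ≡⟨ toℚ-det-◃ n N u ⟩
      Σℚ (suc n) (λ i → y i * toℚ (u i))
        ≡⟨ Σℚ.Σ-cong (suc n) (λ i → trans (cong (y i *_) (u≡ i))
             (sym (Σℚ.Σ-* m (y i) (λ j → c j * toℚ (A i j))))) ⟩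
      Σℚ (suc n) (λ i → Σℚ m (λ j → y i * (c j * toℚ (A i j))))
        ≡⟨ Σℚ.Σ-swap (suc n) m (λ i j → y i * (c j * toℚ (A i j))) ⟩
      Σℚ m (λ j → Σℚ (suc n) (λ i → y i * (c j * toℚ (A i j))))
        ≡⟨ Σℚ.Σ-cong m (λ j → trans
             (Σℚ.Σ-cong (suc n) (λ i → *-exchange (y i) (c j) (toℚ (A i j))))
             (Σℚ.Σ-* (suc n) (c j) (λ i → y i * toℚ (A i j)))) ⟩
      Σℚ m (λ j → c j * Σℚ (suc n) (λ i → y i * toℚ (A i j)))
        ≡⟨ Σℚ.Σ-cong m (λ j → cong (c j *_) (sym (toℚ-det-◃ n N (λ i → A i j)))) ⟩
      Σℚ m (λ j → c j * toℚ (det (suc n) ((λ i → A i j) ◃ N)))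
        ≡⟨ Σℚ.Σ-0 m term≡0 ⟩
      0ℚ ∎

module _ {n m k} (A : Matrix n m) (T₁ T₂ : Fin m → Bool) (σ : Fin k → Fin m) (β : Fin k → ℤ)
  (β-off : ∀ l → T₁ (σ l) ∨ T₂ (σ l) ≡ false → β l ≡ ℤ.+ 0) where

  private
    γ₁ γ₂ : Fin k → ℤ
    -- A column in both sets is credited to `T₁` as a whole, so no coefficient is divided and
    -- integrality survives.
    γ₁ l = if T₁ (σ l) then β l else ℤ.+ 0
    γ₂ l = if T₁ (σ l) then ℤ.+ 0 else β l

    β≡γ₁+γ₂ : ∀ l → β l ≡ γ₁ l ℤ.+ γ₂ l
    β≡γ₁+γ₂ l with T₁ (σ l)
    ... | true  = sym (ℤ.+-identityʳ (β l))
    ... | false = sym (ℤ.+-identityˡ (β l))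

    γ₁-off : ∀ l → T₁ (σ l) ≡ false → γ₁ l ≡ ℤ.+ 0
    γ₁-off l eq rewrite eq = refl

    γ₂-off : ∀ l → T₂ (σ l) ≡ false → γ₂ l ≡ ℤ.+ 0
    γ₂-off l eq with T₁ (σ l) in eq₁
    ... | true  = refl
    ... | false = β-off l (cong₂ _∨_ eq₁ eq)

  splitCombination :
    ∃ λ u₁ → ∃ λ u₂ → ColSpan A T₁ (toℚ ∘ u₁) × ColSpan A T₂ (toℚ ∘ u₂) ×
      (∀ i → Σℤ k (λ l → β l ℤ.* A i (σ l)) ≡ u₁ i ℤ.+ u₂ i)
  splitCombination =
    (λ i → Σℤ k (λ l → γ₁ l ℤ.* A i (σ l))) ,
    (λ i → Σℤ k (λ l → γ₂ l ℤ.* A i (σ l))) ,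
    colSpan-Σ A T₁ k σ γ₁ γ₁-off ,
    colSpan-Σ A T₂ k σ γ₂ γ₂-off ,
    λ i → trans
      (Σℤ.Σ-cong k (λ l → trans (cong (ℤ._* A i (σ l)) (β≡γ₁+γ₂ l))
        (ℤ.*-distribʳ-+ (A i (σ l)) (γ₁ l) (γ₂ l))))
      (Σℤ.Σ-+ k (λ l → γ₁ l ℤ.* A i (σ l)) (λ l → γ₂ l ℤ.* A i (σ l)))

splitIntegral : ∀ {n m} (A : Matrix n m) → Unimodular A → ∀ T₁ T₂ (u : Fin n → ℤ) →
  ColSpan A (λ j → T₁ j ∨ T₂ j) (toℚ ∘ u) →
  ∃ λ u₁ → ∃ λ u₂ → ColSpan A T₁ (toℚ ∘ u₁) × ColSpan A T₂ (toℚ ∘ u₂) ×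
    (∀ i → u i ≡ u₁ i ℤ.+ u₂ i)
-- Exchanging a basis column needs at least one row; in dimension 0 every equation between vectors
-- is vacuous.
splitIntegral {zero} {m} A uni T₁ T₂ u u∈ = u , u , empty T₁ , empty T₂ , λ ()
  where
  empty : ∀ T → ColSpan A T (toℚ ∘ u)
  empty T = (λ _ → 0ℚ) , (λ _ _ → refl) , λ ()
splitIntegral {suc n} {m} A uni T₁ T₂ u u∈ =
  let T = λ j → T₁ j ∨ T₂ j
      σ , σ≢0 , adapted = basisAdaptedTo A T (proj₁ uni)
      unit = minor-unit A uni σ σ≢0
      u₁ , u₂ , u₁∈ , u₂∈ , sum≡ = splitCombination A T₁ T₂ σ (coordinate A σ unit u)
        (λ k σk∉T → coordinate-off A σ unit u T u∈ k (λ j → adapted k j σk∉T))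
  in u₁ , u₂ , u₁∈ , u₂∈ , λ i → trans (coordinates-sum A σ unit u i) (sum≡ i)

-- Order on ℚ and linear functionals.

0≤1 : 0ℚ ≤ 1ℚ
0≤1 = ℚ.<⇒≤ (ℚ.positive⁻¹ 1ℚ)

0≤-* : ∀ {p q} → 0ℚ ≤ p → 0ℚ ≤ q → 0ℚ ≤ p * q
0≤-* {p} {q} 0≤p 0≤q = ℚ.nonNegative⁻¹ (p * q)
  {{ℚ.nonNeg*nonNeg⇒nonNeg p {{ℚ.nonNegative 0≤p}} q {{ℚ.nonNegative 0≤q}}}}

0≤-+ : ∀ {p q} → 0ℚ ≤ p → 0ℚ ≤ q → 0ℚ ≤ p + q
0≤-+ 0≤p 0≤q = ℚ.+-mono-≤ 0≤p 0≤q

*-monoˡ : ∀ r {p q} → 0ℚ ≤ r → p ≤ q → r * p ≤ r * q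
*-monoˡ r 0≤r = ℚ.*-monoˡ-≤-nonNeg r {{ℚ.nonNegative 0≤r}}

p-q+q≡p : ∀ p q → (p - q) + q ≡ p
p-q+q≡p = solve-∀ ℚ-ring

p≡q+[p-q] : ∀ p q → p ≡ q + (p - q)
p≡q+[p-q] = solve-∀ ℚ-ring

≤⇒0≤- : ∀ {p q} → p ≤ q → 0ℚ ≤ q - p
≤⇒0≤- {p} {q} p≤q = subst (_≤ q - p) (ℚ.+-inverseʳ p) (ℚ.+-monoˡ-≤ (- p) p≤q)

0≤-⇒≤ : ∀ {p q} → 0ℚ ≤ q - p → p ≤ q
0≤-⇒≤ {p} {q} 0≤q-p = subst₂ _≤_ (ℚ.+-identityˡ p) (p-q+q≡p q p) (ℚ.+-monoˡ-≤ p 0≤q-p)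

-≡0⇒≡ : ∀ {p q} → q - p ≡ 0ℚ → p ≡ q
-≡0⇒≡ {p} {q} q-p≡0 = trans (sym (ℚ.+-identityˡ p)) (trans (cong (_+ p) (sym q-p≡0)) (p-q+q≡p q p))

*-solve : ∀ {d} → d ≢ 0ℚ → ∀ e → ∃ λ t → d * t ≡ e
*-solve {d} d≢0 e = (ℚ.1/ d) * e , (begin
  d * ((ℚ.1/ d) * e)  ≡⟨ sym (ℚ.*-assoc d (ℚ.1/ d) e) ⟩
  (d * ℚ.1/ d) * e    ≡⟨ cong (_* e) (ℚ.*-inverseʳ d) ⟩
  1ℚ * e              ≡⟨ ℚ.*-identityˡ e ⟩
  e                   ∎)
  where instance _ = ℚ.≢-nonZero d≢0

Σ-mono : ∀ k {f g} → (∀ j → f j ≤ g j) → Σℚ k f ≤ Σℚ k g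
Σ-mono zero    f≤g = ℚ.≤-refl
Σ-mono (suc k) f≤g = ℚ.+-mono-≤ (f≤g zero) (Σ-mono k (f≤g ∘ suc))

Σ-nonNeg : ∀ k {f} → (∀ j → 0ℚ ≤ f j) → 0ℚ ≤ Σℚ k f
Σ-nonNeg zero    0≤f = ℚ.≤-refl
Σ-nonNeg (suc k) 0≤f = 0≤-+ (0≤f zero) (Σ-nonNeg k (0≤f ∘ suc))

Σ≡0⇒≡0 : ∀ k {f} → (∀ j → 0ℚ ≤ f j) → Σℚ k f ≡ 0ℚ → ∀ j → f j ≡ 0ℚ
Σ≡0⇒≡0 (suc k) {f} 0≤f Σ≡0 = λ { zero → f₀≡0 ; (suc j) → Σ≡0⇒≡0 k (0≤f ∘ suc) rest≡0 j }
  where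
  f₀≡0 : f zero ≡ 0ℚ
  f₀≡0 = ℚ.≤-antisym
    (subst₂ _≤_ (ℚ.+-identityʳ (f zero)) Σ≡0 (ℚ.+-monoʳ-≤ (f zero) (Σ-nonNeg k (0≤f ∘ suc))))
    (0≤f zero)

  rest≡0 : Σℚ k (f ∘ suc) ≡ 0ℚ
  rest≡0 = trans (sym (ℚ.+-identityˡ _)) (trans (cong (_+ Σℚ k (f ∘ suc)) (sym f₀≡0)) Σ≡0)

module _ {n} (c : Pt n) where

  dot-cong : ∀ {x y} → (∀ i → x i ≡ y i) → dot c x ≡ dot c y
  dot-cong x≗y = Σℚ.Σ-cong n (λ i → cong (c i *_) (x≗y i))

  dot-+ : ∀ x y → dot c (λ i → x i + y i) ≡ dot c x + dot c y
  dot-+ x y = trans (Σℚ.Σ-cong n (λ i → ℚ.*-distribˡ-+ (c i) (x i) (y i)))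
    (Σℚ.Σ-+ n (λ i → c i * x i) (λ i → c i * y i))

  dot-* : ∀ l x → dot c (λ i → l * x i) ≡ l * dot c x
  dot-* l x = trans (Σℚ.Σ-cong n (λ i → *-exchange (c i) l (x i))) (Σℚ.Σ-* n l (λ i → c i * x i))

  dot-sub : ∀ x y → dot c (λ i → x i - y i) ≡ dot c x - dot c y
  dot-sub x y = begin
    dot c (λ i → x i - y i)                ≡⟨ dot-cong (λ i → neg-as-* (x i) (y i)) ⟩
    dot c (λ i → x i + (- 1ℚ) * y i)       ≡⟨ dot-+ x _ ⟩
    dot c x + dot c (λ i → (- 1ℚ) * y i)   ≡⟨ cong (dot c x +_) (dot-* (- 1ℚ) y) ⟩
    dot c x + (- 1ℚ) * dot c y             ≡⟨ sym (neg-as-* (dot c x) (dot c y)) ⟩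
    dot c x - dot c y                      ∎
    where
    neg-as-* : ∀ x y → x - y ≡ x + (- 1ℚ) * y
    neg-as-* = solve-∀ ℚ-ring

  dot-Σ : ∀ k (μ : Fin k → ℚ) (p : Fin k → Pt n) →
          dot c (λ i → Σℚ k (λ j → μ j * p j i)) ≡ Σℚ k (λ j → μ j * dot c (p j))
  dot-Σ k μ p = begin
    Σℚ n (λ i → c i * Σℚ k (λ j → μ j * p j i))
      ≡⟨ Σℚ.Σ-cong n (λ i → sym (Σℚ.Σ-* k (c i) (λ j → μ j * p j i))) ⟩
    Σℚ n (λ i → Σℚ k (λ j → c i * (μ j * p j i)))
      ≡⟨ Σℚ.Σ-swap n k (λ i j → c i * (μ j * p j i)) ⟩
    Σℚ k (λ j → dot c (λ i → μ j * p j i))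
      ≡⟨ Σℚ.Σ-cong k (λ j → dot-* (μ j) (p j)) ⟩
    Σℚ k (λ j → μ j * dot c (p j)) ∎

dot-comm : ∀ {n} (c x : Pt n) → dot c x ≡ dot x c
dot-comm {n} c x = Σℚ.Σ-cong n (λ i → ℚ.*-comm (c i) (x i))

-- Intersections of halfspaces.

-- An arbitrary predicate on points need not respect pointwise equality; one given by inequalities
-- does, because it sees a point only through dot products.
polyhedron-resp : ∀ {n} {P : PSet n} → IsPolyhedron P → ∀ {x y} → (∀ i → x i ≡ y i) → P x → P y
polyhedron-resp (k , C , b , P⇒ , ⇒P) {x} {y} x≗y x∈P =
  ⇒P y (λ r → subst (_≤ b r) (dot-cong (C r) x≗y) (P⇒ x x∈P r))

module _ {n : ℕ} where

  ≐-trans : ∀ {P Q R : PSet n} → P ≐ Q → Q ≐ R → P ≐ R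
  ≐-trans (P⊆Q , Q⊆P) (Q⊆R , R⊆Q) = (λ x → Q⊆R x ∘ P⊆Q x) , (λ x → Q⊆P x ∘ R⊆Q x)

  ≐-sym : ∀ {P Q : PSet n} → P ≐ Q → Q ≐ P
  ≐-sym (P⊆Q , Q⊆P) = Q⊆P , P⊆Q

  isPolyhedron-≐ : ∀ {P Q : PSet n} → P ≐ Q → IsPolyhedron Q → IsPolyhedron P
  isPolyhedron-≐ P≐Q (k , C , b , Q≐) = k , C , b , ≐-trans P≐Q Q≐

  halfspace : ∀ (c : Pt n) β → IsPolyhedron (λ x → dot c x ≤ β)
  halfspace c β = 1 , (λ _ → c) , (λ _ → β) , (λ x c≤β _ → c≤β) , (λ x c≤β → c≤β zero)

  ⋂-∅ : ∀ {P : Fin 0 → PSet n} → IsPolyhedron (λ x → ∀ r → P r x)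
  ⋂-∅ = 0 , (λ ()) , (λ ()) , (λ _ _ ()) , (λ _ _ ())

  infixr 6 _∩ₚ_

  _∩ₚ_ : ∀ {P Q : PSet n} → IsPolyhedron P → IsPolyhedron Q → IsPolyhedron (λ x → P x × Q x)
  (k , C , b , P⇒ , ⇒P) ∩ₚ (l , D , d , Q⇒ , ⇒Q) =
    k ℕ.+ l , proj₁ ∘ (H ++ K) , proj₂ ∘ (H ++ K) ,
    (λ x (x∈P , x∈Q) → All.++⁺ (Sat x) {H} {K} (P⇒ x x∈P) (Q⇒ x x∈Q)) ,
    (λ x sat → ⇒P x (proj₁ (All.++⁻ (Sat x) H {K} sat)) ,
               ⇒Q x (proj₂ (All.++⁻ (Sat x) H {K} sat)))
    where
    Sat : Pt n → Pt n × ℚ → Set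
    Sat x (c , β) = dot c x ≤ β

    H : Vector (Pt n × ℚ) k
    H r = C r , b r

    K : Vector (Pt n × ℚ) l
    K r = D r , d r

  ⋂ : ∀ k {P : Fin k → PSet n} → (∀ r → IsPolyhedron (P r)) → IsPolyhedron (λ x → ∀ r → P r x)
  ⋂ zero    poly = ⋂-∅
  ⋂ (suc k) poly = isPolyhedron-≐
    ((λ x all → all zero , all ∘ suc) , (λ x (h , t) → λ { zero → h ; (suc r) → t r }))
    (poly zero ∩ₚ ⋂ k (poly ∘ suc))

  -- A decidable condition selects either `P` or the whole space. Elimination can thus range over
  -- all rows and all pairs of rows without sorting them by sign.
  guard : ∀ {G : Set} {P : PSet n} → Dec G → IsPolyhedron P → IsPolyhedron (λ x → G → P x)
  guard (yes g)  poly = isPolyhedron-≐ ((λ x f → f g) , (λ x p _ → p)) poly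
  guard (no ¬g) poly = isPolyhedron-≐ {Q = λ x → (r : Fin 0) → dot (λ _ → 0ℚ) x ≤ 0ℚ}
    ((λ _ _ ()) , (λ _ _ g → contradiction g ¬g)) ⋂-∅

-- Fourier–Motzkin elimination

-- Solutions of d t ≤ e form half-lines, so it suffices that they meet pairwise.
commonSolution : ∀ k (d e : Fin k → ℚ) →
  (∀ r → d r ≡ 0ℚ → 0ℚ ≤ e r) →
  (∀ r s → 0ℚ < d r → d s < 0ℚ → d s * e r ≤ d r * e s) →
  ∃ λ t → ∀ r → d r * t ≤ e r
commonSolution zero    d e flat cross = 0ℚ , λ ()
commonSolution (suc k) d e flat cross
  with commonSolution k (d ∘ suc) (e ∘ suc) (flat ∘ suc) (λ r s → cross (suc r) (suc s))
... | t , sol with d zero * t ℚ.≤? e zero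
...   | yes d₀t≤e₀ = t , λ { zero → d₀t≤e₀ ; (suc r) → sol r }
...   | no d₀t≰e₀ with ℚ.<-cmp (d zero) 0ℚ
...     | tri≈ _ d₀≡0 _ = contradiction
            (subst (_≤ e zero) (sym (trans (cong (_* t) d₀≡0) (ℚ.*-zeroˡ t))) (flat zero d₀≡0)) d₀t≰e₀
-- The violated row is an upper bound, so `t` is lowered to its boundary `t′`. Rows with nonnegative
-- coefficient stay satisfied; the others hold at `t′` by their cross condition with row `zero`. The
-- case of a lower bound is symmetric.
...     | tri> _ d₀≢0 d₀>0 with *-solve d₀≢0 (e zero)
...       | t′ , d₀t′≡e₀ = t′ , λ { zero → ℚ.≤-reflexive d₀t′≡e₀ ; (suc r) → sol′ r }
  where
  t′≤t : t′ ≤ t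
  t′≤t = ℚ.*-cancelˡ-≤-pos (d zero) {{ℚ.positive d₀>0}}
    (subst (_≤ d zero * t) (sym d₀t′≡e₀) (ℚ.<⇒≤ (ℚ.≰⇒> d₀t≰e₀)))

  sol′ : ∀ r → d (suc r) * t′ ≤ e (suc r)
  sol′ r with 0ℚ ℚ.≤? d (suc r)
  ... | yes 0≤d = ℚ.≤-trans (*-monoˡ (d (suc r)) 0≤d t′≤t) (sol r)
  ... | no 0≰d = ℚ.*-cancelˡ-≤-pos (d zero) {{ℚ.positive d₀>0}}
          (subst (_≤ d zero * e (suc r))
            (sym (trans (*-exchange (d zero) (d (suc r)) t′) (cong (d (suc r) *_) d₀t′≡e₀)))
            (cross zero (suc r) d₀>0 (ℚ.≰⇒> 0≰d)))
commonSolution (suc k) d e flat cross | t , sol | no d₀t≰e₀ | tri< d₀<0 d₀≢0 _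
  with *-solve d₀≢0 (e zero)
...       | t′ , d₀t′≡e₀ = t′ , λ { zero → ℚ.≤-reflexive d₀t′≡e₀ ; (suc r) → sol′ r }
  where
  t≤t′ : t ≤ t′
  t≤t′ = ℚ.*-cancelˡ-≤-neg (d zero) {{ℚ.negative d₀<0}}
    (subst (_≤ d zero * t) (sym d₀t′≡e₀) (ℚ.<⇒≤ (ℚ.≰⇒> d₀t≰e₀)))

  sol′ : ∀ r → d (suc r) * t′ ≤ e (suc r)
  sol′ r with d (suc r) ℚ.≤? 0ℚ
  ... | yes d≤0 = ℚ.≤-trans
          (ℚ.*-monoˡ-≤-nonPos (d (suc r)) {{ℚ.nonPositive d≤0}} t≤t′) (sol r)
  ... | no d≰0 = ℚ.*-cancelˡ-≤-neg (d zero) {{ℚ.negative d₀<0}}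
          (subst (d zero * e (suc r) ≤_)
            (sym (trans (*-exchange (d zero) (d (suc r)) t′) (cong (d (suc r) *_) d₀t′≡e₀)))
            (cross (suc r) zero (ℚ.≰⇒> d≰0) d₀<0))

commonSolution⁻ : ∀ {k} (d e : Fin k → ℚ) t → (∀ r → d r * t ≤ e r) →
  (∀ r → d r ≡ 0ℚ → 0ℚ ≤ e r) ×
  (∀ r s → 0ℚ < d r → d s < 0ℚ → d s * e r ≤ d r * e s)
commonSolution⁻ d e t sol =
  (λ r d≡0 → subst (_≤ e r) (trans (cong (_* t) d≡0) (ℚ.*-zeroˡ t)) (sol r)) ,
  λ r s 0<dr ds<0 → ℚ.≤-trans
    (ℚ.*-monoˡ-≤-nonPos (d s) {{ℚ.nonPositive (ℚ.<⇒≤ ds<0)}} (sol r))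
    (subst (_≤ d r * e s) (*-exchange (d r) (d s) t) (*-monoˡ (d r) (ℚ.<⇒≤ 0<dr) (sol s)))

module _ {n : ℕ} where

  -- Rows free of `t` are kept, and each pair of rows with coefficients of opposite sign is combined
  -- so that `t` cancels. The gap of a combined row is exactly the cross condition of
  -- `commonSolution`.
  eliminate : ∀ {P : PSet (suc n)} → IsPolyhedron P → IsPolyhedron (λ x → ∃ λ t → P (t ∷ x))
  eliminate {P} (k , C , b , P⇒ , ⇒P) = isPolyhedron-≐ (to , from)
    (⋂ k (λ r → guard (d r ℚ.≟ 0ℚ) (halfspace (a r) (b r))) ∩ₚ
     ⋂ k (λ r → ⋂ k (λ s → guard ((0ℚ ℚ.<? d r) ×-dec (d s ℚ.<? 0ℚ))
       (halfspace (λ i → d r * a s i - d s * a r i) (d r * b s - d s * b r)))))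
    where
    d : Fin k → ℚ
    d r = C r zero

    a : Fin k → Pt n
    a r = C r ∘ suc

    e : Pt n → Fin k → ℚ
    e x r = b r - dot (a r) x

    Eliminated : PSet n
    Eliminated x = (∀ r → d r ≡ 0ℚ → dot (a r) x ≤ b r) ×
      (∀ r s → 0ℚ < d r × d s < 0ℚ →
        dot (λ i → d r * a s i - d s * a r i) x ≤ d r * b s - d s * b r)

    cross-dot : ∀ r s x → dot (λ i → d r * a s i - d s * a r i) x ≡
                d r * dot (a s) x - d s * dot (a r) x
    cross-dot r s x = begin
      dot (λ i → d r * a s i - d s * a r i) x
        ≡⟨ dot-comm (λ i → d r * a s i - d s * a r i) x ⟩
      dot x (λ i → d r * a s i - d s * a r i)
        ≡⟨ dot-sub x (λ i → d r * a s i) (λ i → d s * a r i) ⟩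
      dot x (λ i → d r * a s i) - dot x (λ i → d s * a r i)
        ≡⟨ cong₂ _-_ (dot-* x (d r) (a s)) (dot-* x (d s) (a r)) ⟩
      d r * dot x (a s) - d s * dot x (a r)
        ≡⟨ cong₂ (λ p q → d r * p - d s * q) (dot-comm x (a s)) (dot-comm x (a r)) ⟩
      d r * dot (a s) x - d s * dot (a r) x ∎

    gap : ∀ d d′ b b′ p p′ → (d * b′ - d′ * b) - (d * p′ - d′ * p) ≡ d * (b′ - p′) - d′ * (b - p)
    gap = solve-∀ ℚ-ring

    cross-gap : ∀ r s x → (d r * b s - d s * b r) - dot (λ i → d r * a s i - d s * a r i) x ≡
                d r * e x s - d s * e x r
    cross-gap r s x = trans (cong (λ p → (d r * b s - d s * b r) - p) (cross-dot r s x))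
      (gap (d r) (d s) (b r) (b s) (dot (a r) x) (dot (a s) x))

    rotate : ∀ b p q → b - (p + q) ≡ (b - q) - p
    rotate = solve-∀ ℚ-ring

    to : ∀ x → (∃ λ t → P (t ∷ x)) → Eliminated x
    to x (t , tx∈P) =
      let flat , cross = commonSolution⁻ d (e x) t
            (λ r → 0≤-⇒≤ (subst (0ℚ ≤_) (rotate (b r) (d r * t) (dot (a r) x))
              (≤⇒0≤- (P⇒ (t ∷ x) tx∈P r))))
      in (λ r d≡0 → 0≤-⇒≤ (flat r d≡0)) ,
         (λ r s (0<dr , ds<0) → 0≤-⇒≤
           (subst (0ℚ ≤_) (sym (cross-gap r s x)) (≤⇒0≤- (cross r s 0<dr ds<0))))

    from : ∀ x → Eliminated x → ∃ λ t → P (t ∷ x)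
    from x (flat , cross) =
      let t , sol = commonSolution k d (e x)
            (λ r d≡0 → ≤⇒0≤- (flat r d≡0))
            (λ r s 0<dr ds<0 → 0≤-⇒≤
              (subst (0ℚ ≤_) (cross-gap r s x) (≤⇒0≤- (cross r s (0<dr , ds<0)))))
      in t , ⇒P (t ∷ x) (λ r → 0≤-⇒≤ (subst (0ℚ ≤_)
           (sym (rotate (b r) (d r * t) (dot (a r) x))) (≤⇒0≤- (sol r))))

module _ {n : ℕ} where

  -- The recursion puts the coordinates to be eliminated in front and unfolds definitionally to the
  -- form `t ∷ x` that `eliminate` expects.
  glue : ∀ k → Pt k → Pt n → Pt (k ℕ.+ n)
  glue zero    y x = x
  glue (suc k) y x = y zero ∷ glue k (y ∘ suc) x

  dot-glue : ∀ k c c′ y x → dot (glue k c c′) (glue k y x) ≡ dot c y + dot c′ x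
  dot-glue zero    c c′ y x = sym (ℚ.+-identityˡ (dot c′ x))
  dot-glue (suc k) c c′ y x = trans
    (cong (c zero * y zero +_) (dot-glue k (c ∘ suc) c′ (y ∘ suc) x))
    (sym (ℚ.+-assoc (c zero * y zero) (dot (c ∘ suc) (y ∘ suc)) (dot c′ x)))

  project : ∀ k {Q : PSet (k ℕ.+ n)} → IsPolyhedron Q →
            IsPolyhedron (λ x → ∃ λ y → Q (glue k y x))
  project zero    poly = isPolyhedron-≐ ((λ x (_ , q) → q) , (λ x q → (λ ()) , q)) poly
  project (suc k) poly = isPolyhedron-≐
    ((λ x (y , q) → y ∘ suc , y zero , q) , (λ x (y , t , q) → t ∷ y , q))
    (project k (eliminate poly))

-- Minkowski sums of polyhedra.

difference : ∀ x y z → x ≡ y + z → z ≡ x - y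
difference x y z refl = cancel y z
  where
  cancel : ∀ y z → z ≡ (y + z) - y
  cancel = solve-∀ ℚ-ring

-- The sum is the projection to x of the pairs (y, x) with y in `P₁` and x - y in `P₂`; the second
-- summand is determined by the pair, so only the `n` coordinates of y are eliminated.
isPolyhedron-⊕ : ∀ {n} {P₁ P₂ : PSet n} → IsPolyhedron P₁ → IsPolyhedron P₂ →
                 IsPolyhedron (P₁ ⊕ P₂)
isPolyhedron-⊕ {n} {P₁} {P₂} poly₁@(k , C , b , P₁⇒ , ⇒P₁) poly₂@(l , D , d , P₂⇒ , ⇒P₂) =
  isPolyhedron-≐ (to , from) (project n {Q}
    (⋂ k (λ r → halfspace (glue n (C r) (λ _ → 0ℚ)) (b r)) ∩ₚ
     ⋂ l (λ r → halfspace (glue n (λ i → (- 1ℚ) * D r i) (D r)) (d r))))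
  where
  Q : PSet (n ℕ.+ n)
  Q z = (∀ r → dot (glue n (C r) (λ _ → 0ℚ)) z ≤ b r) ×
        (∀ r → dot (glue n (λ i → (- 1ℚ) * D r i) (D r)) z ≤ d r)

  dot₁ : ∀ r y x → dot (glue n (C r) (λ _ → 0ℚ)) (glue n y x) ≡ dot (C r) y
  dot₁ r y x = trans (dot-glue n (C r) (λ _ → 0ℚ) y x)
    (trans (cong (dot (C r) y +_) (Σℚ.Σ-0 n (λ i → ℚ.*-zeroˡ (x i)))) (ℚ.+-identityʳ (dot (C r) y)))

  neg : ∀ p q → (- 1ℚ) * p + q ≡ q - p
  neg = solve-∀ ℚ-ring

  dot₂ : ∀ r y x → dot (glue n (λ i → (- 1ℚ) * D r i) (D r)) (glue n y x) ≡
         dot (D r) (λ i → x i - y i)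
  dot₂ r y x = begin
    dot (glue n (λ i → (- 1ℚ) * D r i) (D r)) (glue n y x)
      ≡⟨ dot-glue n (λ i → (- 1ℚ) * D r i) (D r) y x ⟩
    dot (λ i → (- 1ℚ) * D r i) y + dot (D r) x
      ≡⟨ cong (_+ dot (D r) x) (trans (dot-comm (λ i → (- 1ℚ) * D r i) y)
           (trans (dot-* y (- 1ℚ) (D r)) (cong ((- 1ℚ) *_) (dot-comm y (D r))))) ⟩
    (- 1ℚ) * dot (D r) y + dot (D r) x
      ≡⟨ neg (dot (D r) y) (dot (D r) x) ⟩
    dot (D r) x - dot (D r) y
      ≡⟨ sym (dot-sub (D r) x y) ⟩
    dot (D r) (λ i → x i - y i) ∎

  to : ∀ x → (P₁ ⊕ P₂) x → ∃ λ y → Q (glue n y x)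
  to x (y , z , y∈ , z∈ , x≡y+z) = y ,
    (λ r → subst (_≤ b r) (sym (dot₁ r y x)) (P₁⇒ y y∈ r)) ,
    (λ r → subst (_≤ d r)
      (trans (dot-cong (D r) (λ i → difference (x i) (y i) (z i) (x≡y+z i))) (sym (dot₂ r y x)))
      (P₂⇒ z z∈ r))

  from : ∀ x → (∃ λ y → Q (glue n y x)) → (P₁ ⊕ P₂) x
  from x (y , q₁ , q₂) = y , (λ i → x i - y i) ,
    ⇒P₁ y (λ r → subst (_≤ b r) (dot₁ r y x) (q₁ r)) ,
    ⇒P₂ _ (λ r → subst (_≤ d r) (dot₂ r y x) (q₂ r)) ,
    λ i → p≡q+[p-q] (x i) (y i)

-- Convex hulls

Conv-mono : ∀ {n} {S T : PSet n} → S ⊆ T → Conv S ⊆ Conv T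
Conv-mono S⊆T x (k , p , μ , p∈S , rest) = k , p , μ , (λ j → S⊆T (p j) (p∈S j)) , rest

Conv-polyhedron : ∀ {n} {P : PSet n} → IsPolyhedron P → Conv P ⊆ P
Conv-polyhedron {n} (l , C , b , P⇒ , ⇒P) x (k , p , μ , p∈P , 0≤μ , Σμ≡1 , x≡) =
  ⇒P x λ r → subst₂ _≤_
    (sym (trans (dot-cong (C r) x≡) (dot-Σ (C r) k μ p)))
    (trans (trans (Σℚ.Σ-cong k (λ j → ℚ.*-comm (μ j) (b r))) (Σℚ.Σ-* k (b r) μ))
      (trans (cong (b r *_) Σμ≡1) (ℚ.*-identityʳ (b r))))
    (Σ-mono k (λ j → *-monoˡ (μ j) (0≤μ j) (P⇒ (p j) (p∈P j) r)))

Σ-++ : ∀ k l (f : Fin k ⊎ Fin l → ℚ) →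
       Σℚ (k ℕ.+ l) (f ∘ splitAt k) ≡ Σℚ k (f ∘ inj₁) + Σℚ l (f ∘ inj₂)
Σ-++ zero    l f = sym (ℚ.+-identityˡ _)
Σ-++ (suc k) l f = trans
  (cong (f (inj₁ zero) +_) (trans (Σℚ.Σ-cong (k ℕ.+ l) (λ j → shift j))
    (Σ-++ k l [ f ∘ inj₁ ∘ suc , f ∘ inj₂ ]′)))
  (sym (ℚ.+-assoc (f (inj₁ zero)) _ _))
  where
  shift : ∀ j → f (splitAt (suc k) (suc j)) ≡ [ f ∘ inj₁ ∘ suc , f ∘ inj₂ ]′ (splitAt k j)
  shift j with splitAt k j
  ... | inj₁ _ = refl
  ... | inj₂ _ = refl

Σ-remQuot : ∀ k l (f : Fin k × Fin l → ℚ) →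
            Σℚ (k ℕ.* l) (f ∘ remQuot l) ≡ Σℚ k (λ i → Σℚ l (λ j → f (i , j)))
Σ-remQuot zero    l f = refl
Σ-remQuot (suc k) l f = begin
  Σℚ (l ℕ.+ k ℕ.* l) (f ∘ remQuot {suc k} l)
    ≡⟨ Σℚ.Σ-cong (l ℕ.+ k ℕ.* l) shift ⟩
  Σℚ (l ℕ.+ k ℕ.* l) (g ∘ splitAt l)
    ≡⟨ Σ-++ l (k ℕ.* l) g ⟩
  Σℚ l (λ j → f (zero , j)) + Σℚ (k ℕ.* l) (λ r → f (next (remQuot {k} l r)))
    ≡⟨ cong (Σℚ l (λ j → f (zero , j)) +_) (Σ-remQuot k l (f ∘ next)) ⟩
  Σℚ l (λ j → f (zero , j)) + Σℚ k (λ i → Σℚ l (λ j → f (suc i , j))) ∎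
  where
  next : Fin k × Fin l → Fin (suc k) × Fin l
  next (i , j) = suc i , j

  g : Fin l ⊎ Fin (k ℕ.* l) → ℚ
  g = [ (λ j → f (zero , j)) , (λ r → f (next (remQuot {k} l r))) ]′

  shift : ∀ r → f (remQuot {suc k} l r) ≡ g (splitAt l r)
  shift r with splitAt l r
  ... | inj₁ _ = refl
  ... | inj₂ _ = refl

-- The sums `p a + q b` with the product weights `μ a * ν b`: each family of weights sums to 1, so
-- summing out one index leaves the other combination unchanged.
Conv-⊕ : ∀ {n} {S T : PSet n} → (Conv S ⊕ Conv T) ⊆ Conv (S ⊕ T)
Conv-⊕ x (y , z , (k , p , μ , p∈S , 0≤μ , Σμ≡1 , y≡) , (l , q , ν , q∈T , 0≤ν , Σν≡1 , z≡) , x≡) =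
  k ℕ.* l ,
  (λ r i → p (proj₁ (remQuot l r)) i + q (proj₂ (remQuot {k} l r)) i) ,
  (λ r → μ (proj₁ (remQuot l r)) * ν (proj₂ (remQuot {k} l r))) ,
  (λ r → _ , _ , p∈S (proj₁ (remQuot l r)) , q∈T (proj₂ (remQuot {k} l r)) , λ _ → refl) ,
  (λ r → 0≤-* (0≤μ (proj₁ (remQuot l r))) (0≤ν (proj₂ (remQuot {k} l r)))) ,
  trans (Σ-remQuot k l (λ (a , b) → μ a * ν b))
    (trans (Σℚ.Σ-cong k (λ a → trans (Σℚ.Σ-* l (μ a) ν) (trans (cong (μ a *_) Σν≡1) (ℚ.*-identityʳ (μ a)))))
      Σμ≡1) ,
  λ i → trans (x≡ i) (sym (begin
    Σℚ (k ℕ.* l) (λ r → (μ (proj₁ (remQuot l r)) * ν (proj₂ (remQuot {k} l r))) *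
                     (p (proj₁ (remQuot l r)) i + q (proj₂ (remQuot {k} l r)) i))
      ≡⟨ Σ-remQuot k l (λ (a , b) → (μ a * ν b) * (p a i + q b i)) ⟩
    Σℚ k (λ a → Σℚ l (λ b → (μ a * ν b) * (p a i + q b i)))
      ≡⟨ Σℚ.Σ-cong k (λ a → inner a i) ⟩
    Σℚ k (λ a → μ a * p a i + z i * μ a)
      ≡⟨ Σℚ.Σ-+ k (λ a → μ a * p a i) (λ a → z i * μ a) ⟩
    Σℚ k (λ a → μ a * p a i) + Σℚ k (λ a → z i * μ a)
      ≡⟨ cong₂ _+_ (sym (y≡ i)) (trans (Σℚ.Σ-* k (z i) μ)
           (trans (cong (z i *_) Σμ≡1) (ℚ.*-identityʳ (z i)))) ⟩
    y i + z i ∎))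
  where
  expand : ∀ m v a b → (m * v) * (a + b) ≡ (m * a) * v + m * (v * b)
  expand = solve-∀ ℚ-ring

  collect : ∀ m a s → (m * a) * 1ℚ + m * s ≡ m * a + s * m
  collect = solve-∀ ℚ-ring

  inner : ∀ a i → Σℚ l (λ b → (μ a * ν b) * (p a i + q b i)) ≡ μ a * p a i + z i * μ a
  inner a i = begin
    Σℚ l (λ b → (μ a * ν b) * (p a i + q b i))
      ≡⟨ Σℚ.Σ-cong l (λ b → expand (μ a) (ν b) (p a i) (q b i)) ⟩
    Σℚ l (λ b → (μ a * p a i) * ν b + μ a * (ν b * q b i))
      ≡⟨ Σℚ.Σ-+ l (λ b → (μ a * p a i) * ν b) (λ b → μ a * (ν b * q b i)) ⟩
    Σℚ l (λ b → (μ a * p a i) * ν b) + Σℚ l (λ b → μ a * (ν b * q b i))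
      ≡⟨ cong₂ _+_ (Σℚ.Σ-* l (μ a * p a i) ν) (Σℚ.Σ-* l (μ a) (λ b → ν b * q b i)) ⟩
    (μ a * p a i) * Σℚ l ν + μ a * Σℚ l (λ b → ν b * q b i)
      ≡⟨ cong₂ (λ s t → (μ a * p a i) * s + μ a * t) Σν≡1 (sym (z≡ i)) ⟩
    (μ a * p a i) * 1ℚ + μ a * z i
      ≡⟨ collect (μ a) (p a i) (z i) ⟩
    μ a * p a i + z i * μ a ∎

*≡0⇒≡0 : ∀ {p q} → p ≢ 0ℚ → p * q ≡ 0ℚ → q ≡ 0ℚ
*≡0⇒≡0 {p} {q} p≢0 pq≡0 = begin
  q                 ≡⟨ sym (ℚ.*-identityˡ q) ⟩
  1ℚ * q            ≡⟨ cong (_* q) (sym (ℚ.*-inverseˡ p)) ⟩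
  (ℚ.1/ p) * p * q  ≡⟨ ℚ.*-assoc (ℚ.1/ p) p q ⟩
  (ℚ.1/ p) * (p * q) ≡⟨ cong ((ℚ.1/ p) *_) pq≡0 ⟩
  (ℚ.1/ p) * 0ℚ     ≡⟨ ℚ.*-zeroʳ (ℚ.1/ p) ⟩
  0ℚ                ∎
  where instance _ = ℚ.≢-nonZero p≢0

nonzeroSummand : ∀ k (μ : Fin k → ℚ) → Σℚ k μ ≡ 1ℚ → ∃ λ j → μ j ≢ 0ℚ
nonzeroSummand k μ Σμ≡1 with any? (λ j → ¬? (μ j ℚ.≟ 0ℚ))
... | yes found = found
... | no none = contradiction (trans (sym Σμ≡1)
        (Σℚ.Σ-0 k (λ j → decidable-stable (μ j ℚ.≟ 0ℚ) (λ ≢0 → none (j , ≢0))))) ℚ.1≢0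

-- The points of positive weight in a convex combination maximising c maximise c too.
Conv-face : ∀ {n} {S : PSet n} (c : Pt n) δ → (∀ x → S x → dot c x ≤ δ) →
            ∀ y → Conv S y → dot c y ≡ δ → ∃ λ z → S z × dot c z ≡ δ
Conv-face {S = S} c δ bound y (k , p , μ , p∈S , 0≤μ , Σμ≡1 , y≡) cy≡δ =
  let j , μj≢0 = nonzeroSummand k μ Σμ≡1
  in p j , p∈S j , -≡0⇒≡ (*≡0⇒≡0 μj≢0 (Σ≡0⇒≡0 k
       (λ l → 0≤-* (0≤μ l) (≤⇒0≤- (bound (p l) (p∈S l)))) gaps≡0 j))
  where
  gaps≡0 : Σℚ k (λ l → μ l * (δ - dot c (p l))) ≡ 0ℚ
  gaps≡0 = begin
    Σℚ k (λ l → μ l * (δ - dot c (p l)))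
      -- A weighted sum over `k` points is itself a `dot` with `μ`, so the linearity lemmas for
      -- points apply.
      ≡⟨ dot-sub μ (λ _ → δ) (λ l → dot c (p l)) ⟩
    Σℚ k (λ l → μ l * δ) - Σℚ k (λ l → μ l * dot c (p l))
      ≡⟨ cong₂ _-_
           (trans (Σℚ.Σ-cong k (λ l → ℚ.*-comm (μ l) δ)) (trans (Σℚ.Σ-* k δ μ)
             (trans (cong (δ *_) Σμ≡1) (ℚ.*-identityʳ δ))))
           (trans (sym (dot-Σ c k μ p)) (trans (sym (dot-cong c y≡)) cy≡δ)) ⟩
    δ - δ
      ≡⟨ ℚ.+-inverseʳ δ ⟩
    0ℚ ∎

-- The smallest face containing a point.

module ActiveFace {n k} (C : Fin k → Pt n) (b : Fin k → ℚ) (y : Pt n)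
  (y-feasible : ∀ r → dot (C r) y ≤ b r) where

  weight : Fin k → ℚ
  weight r = if does (dot (C r) y ℚ.≟ b r) then 1ℚ else 0ℚ

  -- `IsFace` asks for a single functional. The sum of the rows tight at `y` attains its bound on
  -- the polyhedron exactly where each of these rows is tight.
  normal : Pt n
  normal i = Σℚ k (λ r → weight r * C r i)

  offset : ℚ
  offset = Σℚ k (λ r → weight r * b r)

  0≤weight : ∀ r → 0ℚ ≤ weight r
  0≤weight r with does (dot (C r) y ℚ.≟ b r)
  ... | true  = 0≤1
  ... | false = ℚ.≤-refl

  active-weight : ∀ r → dot (C r) y ≡ b r → weight r ≡ 1ℚ
  active-weight r eq = cong (if_then 1ℚ else 0ℚ) (dec-true (dot (C r) y ℚ.≟ b r) eq)

  weighted : ∀ r → weight r * dot (C r) y ≡ weight r * b r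
  weighted r = helper (dot (C r) y ℚ.≟ b r)
    where
    helper : (d : Dec (dot (C r) y ≡ b r)) →
             (if does d then 1ℚ else 0ℚ) * dot (C r) y ≡ (if does d then 1ℚ else 0ℚ) * b r
    helper (yes eq) = cong (1ℚ *_) eq
    helper (no _)   = trans (ℚ.*-zeroˡ (dot (C r) y)) (sym (ℚ.*-zeroˡ (b r)))

  dot-normal : ∀ x → dot normal x ≡ Σℚ k (λ r → weight r * dot (C r) x)
  dot-normal x = trans (dot-comm normal x) (trans (dot-Σ x k weight C)
    (Σℚ.Σ-cong k (λ r → cong (weight r *_) (dot-comm x (C r)))))

  bound : ∀ x → (∀ r → dot (C r) x ≤ b r) → dot normal x ≤ offset
  bound x feasible = subst (_≤ offset) (sym (dot-normal x))
    (Σ-mono k (λ r → *-monoˡ (weight r) (0≤weight r) (feasible r)))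

  y-attains : dot normal y ≡ offset
  y-attains = trans (dot-normal y) (Σℚ.Σ-cong k weighted)

  attains⇒active : ∀ x → (∀ r → dot (C r) x ≤ b r) → dot normal x ≡ offset →
                   ∀ r → dot (C r) y ≡ b r → dot (C r) x ≡ b r
  attains⇒active x feasible attains r active = -≡0⇒≡ (begin
    b r - dot (C r) x               ≡⟨ sym (ℚ.*-identityˡ _) ⟩
    1ℚ * (b r - dot (C r) x)        ≡⟨ cong (_* (b r - dot (C r) x)) (sym (active-weight r active)) ⟩
    weight r * (b r - dot (C r) x)  ≡⟨ Σ≡0⇒≡0 k
      (λ s → 0≤-* (0≤weight s) (≤⇒0≤- (feasible s))) gaps≡0 r ⟩
    0ℚ                              ∎)
    where
    gaps≡0 : Σℚ k (λ s → weight s * (b s - dot (C s) x)) ≡ 0ℚ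
    gaps≡0 = trans (dot-sub weight b (λ s → dot (C s) x))
      (trans (cong (λ e → offset - e) (trans (sym (dot-normal x)) attains)) (ℚ.+-inverseʳ offset))

module _ {n m} (A : Matrix n m) {P : PSet n} (P∈ : InPA A P) where

  private
    C = proj₁ (proj₂ (proj₁ (proj₁ P∈)))
    b = proj₁ (proj₂ (proj₂ (proj₁ (proj₁ P∈))))
    P⇒ = proj₁ (proj₂ (proj₂ (proj₂ (proj₁ (proj₁ P∈)))))

  -- A vector of the span is a multiple of a difference of two points of the face, and each row
  -- tight at `y` is constant on the face. Adding such a vector to `z` therefore keeps these rows
  -- tight, even where the sum leaves `P`.
  integerPointOfActiveFace : ∀ y → P y →
    ∃ λ T → ∃ λ (z : Fin n → ℤ) → ColSpan A T (λ i → y i - toℚ (z i)) ×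
      (∀ u → ColSpan A T u → ∀ r → dot (C r) y ≡ b r → dot (C r) (λ i → toℚ (z i) + u i) ≡ b r)
  integerPointOfActiveFace y y∈P =
    let z , (z∈P , z-int) , z-attains = Conv-face {S = P ∩ℤ} normal offset
          (λ x (x∈P , _) → bound x (P⇒ x x∈P)) y (proj₁ (proj₂ (proj₁ P∈)) y y∈P) y-attains
        T , span⊆ , ⊆span = proj₂ P∈ F
          ((y , y∈P , y-attains) , normal , offset ,
           (λ x x∈P → bound x (P⇒ x x∈P)) , (λ _ f → f) , (λ _ f → f))
        z≡ = λ i → proj₂ (z-int i)
    in T , (λ i → proj₁ (z-int i)) ,
       span⊆ _ (1ℚ , y , z , (y∈P , y-attains) , (z∈P , z-attains) ,
         λ i → trans (cong (λ e → y i - e) (sym (z≡ i))) (sym (ℚ.*-identityˡ (y i - z i)))) ,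
       λ u u∈T r active →
         let l , p , q , p∈F , q∈F , u≡ = ⊆span u u∈T
         in begin
           dot (C r) (λ i → toℚ (proj₁ (z-int i)) + u i)
             ≡⟨ dot-cong (C r) (λ i → cong₂ _+_ (sym (z≡ i)) (u≡ i)) ⟩
           dot (C r) (λ i → z i + l * (p i - q i))
             ≡⟨ dot-+ (C r) z (λ i → l * (p i - q i)) ⟩
           dot (C r) z + dot (C r) (λ i → l * (p i - q i))
             ≡⟨ cong₂ _+_ (F⇒active (z∈P , z-attains) r active)
                  (trans (dot-* (C r) l (λ i → p i - q i)) (cong (l *_) (trans (dot-sub (C r) p q)
                    (cong₂ _-_ (F⇒active p∈F r active) (F⇒active q∈F r active))))) ⟩
           b r + l * (b r - b r)
             ≡⟨ cancel (b r) l ⟩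
           b r ∎
    where
    open ActiveFace C b y (P⇒ y y∈P)

    F : PSet n
    F x = P x × dot normal x ≡ offset

    F⇒active : ∀ {x} → F x → ∀ r → dot (C r) y ≡ b r → dot (C r) x ≡ b r
    F⇒active {x} (x∈P , attains) = attains⇒active x (P⇒ x x∈P) attains

    cancel : ∀ b l → b + l * (b - b) ≡ b
    cancel = solve-∀ ℚ-ring

-- Rounding along segments.

segment : ∀ {n} → ℚ → Pt n → Pt n → Pt n
segment t x y i = (1ℚ - t) * x i + t * y i

combination-0 : ∀ t → (1ℚ - t) * 0ℚ + t * 0ℚ ≡ 0ℚ
combination-0 = solve-∀ ℚ-ring

-- Move from slacks s towards s′ until a slack that was positive vanishes.
lineSearch : ∀ k (s s′ : Fin k → ℚ) → (∀ r → 0ℚ ≤ s r) → (∀ r → s r ≡ 0ℚ → s′ r ≡ 0ℚ) →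
  ∃ λ t → (∀ r → 0ℚ ≤ (1ℚ - t) * s r + t * s′ r) ×
    (t ≡ 1ℚ ⊎ ∃ λ r → s r ≢ 0ℚ × (1ℚ - t) * s r + t * s′ r ≡ 0ℚ)
lineSearch zero    s s′ 0≤s zeros = 1ℚ , (λ ()) , inj₁ refl
lineSearch (suc k) s s′ 0≤s zeros with lineSearch k (s ∘ suc) (s′ ∘ suc) (0≤s ∘ suc) (zeros ∘ suc)
... | t , 0≤rest , stop with 0ℚ ℚ.≤? (1ℚ - t) * s zero + t * s′ zero
...   | yes 0≤v = t , (λ { zero → 0≤v ; (suc r) → 0≤rest r }) , stop′ stop
  where
  stop′ : (t ≡ 1ℚ ⊎ ∃ λ r → s (suc r) ≢ 0ℚ × (1ℚ - t) * s (suc r) + t * s′ (suc r) ≡ 0ℚ) →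
          (t ≡ 1ℚ ⊎ ∃ λ r → s r ≢ 0ℚ × (1ℚ - t) * s r + t * s′ r ≡ 0ℚ)
  stop′ (inj₁ t≡1)        = inj₁ t≡1
  stop′ (inj₂ (r , hits)) = inj₂ (suc r , hits)
-- Slack `zero` is negative at `t`, so `t` shrinks by the factor `κ` = s₀ / (s₀ - v) at which the
-- segment from s₀ to v crosses 0. Every other slack becomes a convex combination of its nonnegative
-- values at 0 and at `t`.
...   | no 0≰v = κ * t ,
        (λ { zero → ℚ.≤-reflexive (sym hit) ; (suc r) → subst (0ℚ ≤_)
               (reparametrise κ t (s (suc r)) (s′ (suc r)))
               (0≤-+ (0≤-* (≤⇒0≤- κ≤1) (0≤s (suc r))) (0≤-* 0≤κ (0≤rest r))) }) ,
        inj₂ (zero , s₀≢0 , hit)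
  where
  v : ℚ
  v = (1ℚ - t) * s zero + t * s′ zero

  s₀≢0 : s zero ≢ 0ℚ
  s₀≢0 s₀≡0 = 0≰v (ℚ.≤-reflexive (sym (trans
    (cong₂ (λ p q → (1ℚ - t) * p + t * q) s₀≡0 (zeros zero s₀≡0)) (combination-0 t))))

  0<s₀-v : 0ℚ < s zero - v
  0<s₀-v = ℚ.+-mono-≤-< (0≤s zero) (ℚ.neg-antimono-< (ℚ.≰⇒> 0≰v))

  κ-exists : ∃ λ κ → (s zero - v) * κ ≡ s zero
  κ-exists = *-solve (λ eq → ℚ.<⇒≢ 0<s₀-v (sym eq)) (s zero)

  κ : ℚ
  κ = proj₁ κ-exists

  0≤κ : 0ℚ ≤ κ
  0≤κ = ℚ.*-cancelˡ-≤-pos (s zero - v) {{ℚ.positive 0<s₀-v}}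
    (subst₂ _≤_ (sym (ℚ.*-zeroʳ (s zero - v))) (sym (proj₂ κ-exists)) (0≤s zero))

  κ≤1 : κ ≤ 1ℚ
  κ≤1 = ℚ.*-cancelˡ-≤-pos (s zero - v) {{ℚ.positive 0<s₀-v}}
    (subst₂ _≤_ (trans (ℚ.+-identityʳ (s zero)) (sym (proj₂ κ-exists)))
      (sym (ℚ.*-identityʳ (s zero - v)))
      (ℚ.+-monoʳ-≤ (s zero) (ℚ.neg-antimono-≤ (ℚ.<⇒≤ (ℚ.≰⇒> 0≰v)))))

  reparametrise : ∀ κ t s s′ → (1ℚ - κ) * s + κ * ((1ℚ - t) * s + t * s′) ≡
                  (1ℚ - κ * t) * s + (κ * t) * s′
  reparametrise = solve-∀ ℚ-ring

  hit : (1ℚ - κ * t) * s zero + (κ * t) * s′ zero ≡ 0ℚ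
  hit = begin
    (1ℚ - κ * t) * s zero + (κ * t) * s′ zero  ≡⟨ sym (reparametrise κ t (s zero) (s′ zero)) ⟩
    (1ℚ - κ) * s zero + κ * v                  ≡⟨ regroup κ (s zero) v ⟩
    s zero - (s zero - v) * κ                  ≡⟨ cong (λ e → s zero - e) (proj₂ κ-exists) ⟩
    s zero - s zero                            ≡⟨ ℚ.+-inverseʳ (s zero) ⟩
    0ℚ                                         ∎
    where
    regroup : ∀ κ s v → (1ℚ - κ) * s + κ * v ≡ s - (s - v) * κ
    regroup = solve-∀ ℚ-ring

countFalse-≤ : ∀ {k} (p q : Fin k → Bool) → (∀ r → p r ≡ true → q r ≡ true) →
               countFalse q ℕ.≤ countFalse p
countFalse-≤ {zero}  p q p⊆q = ℕ.z≤n
countFalse-≤ {suc k} p q p⊆q with p zero | q zero | p⊆q zero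
... | true  | true  | _ = countFalse-≤ (p ∘ suc) (q ∘ suc) (p⊆q ∘ suc)
... | true  | false | f = contradiction (f refl) λ ()
... | false | true  | _ = ℕ.m≤n⇒m≤1+n (countFalse-≤ (p ∘ suc) (q ∘ suc) (p⊆q ∘ suc))
... | false | false | _ = ℕ.s≤s (countFalse-≤ (p ∘ suc) (q ∘ suc) (p⊆q ∘ suc))

countFalse-< : ∀ {k} (p q : Fin k → Bool) → (∀ r → p r ≡ true → q r ≡ true) →
               ∀ r → p r ≡ false → q r ≡ true → countFalse q ℕ.< countFalse p
countFalse-< p q p⊆q zero p≡false q≡true rewrite p≡false | q≡true =
  ℕ.s≤s (countFalse-≤ (p ∘ suc) (q ∘ suc) (p⊆q ∘ suc))
countFalse-< p q p⊆q (suc r) p≡false q≡true with p zero | q zero | p⊆q zero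
... | true  | true  | _ = countFalse-< (p ∘ suc) (q ∘ suc) (p⊆q ∘ suc) r p≡false q≡true
... | true  | false | f = contradiction (f refl) λ ()
... | false | true  | _ = ℕ.m≤n⇒m≤1+n (countFalse-< (p ∘ suc) (q ∘ suc) (p⊆q ∘ suc) r p≡false q≡true)
... | false | false | _ = ℕ.s≤s (countFalse-< (p ∘ suc) (q ∘ suc) (p⊆q ∘ suc) r p≡false q≡true)

-- Covers both kinds of constraint on y: those of `P₁` at y and those of `P₂` at x - y.
IsAffine : ∀ {n} → (Pt n → ℚ) → Set
IsAffine f = ∀ t x y → f (segment t x y) ≡ (1ℚ - t) * f x + t * f y

-- Either the proposed point y′ is feasible, or some point between y and y′ is
-- feasible and has fewer positive slacks.
module Rounding {n k} (slack : Vector (Pt n → ℚ) k) (affine : All IsAffine slack)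
  (Good : PSet n)
  (propose : ∀ y → All (λ f → 0ℚ ≤ f y) slack →
     ∃ λ y′ → Good y′ × All (λ f → f y ≡ 0ℚ → f y′ ≡ 0ℚ) slack) where

  isZero : Pt n → Fin k → Bool
  isZero y r = does (slack r y ℚ.≟ 0ℚ)

  -- `N` bounds the number of nonzero slacks and makes the recursion structural; a restart preserves
  -- all zero slacks and gains one.
  round′ : ∀ N y → countFalse (isZero y) ℕ.≤ N → All (λ f → 0ℚ ≤ f y) slack →
           ∃ λ y′ → Good y′ × All (λ f → 0ℚ ≤ f y′) slack
  round′ N y count≤N feasible with propose y feasible
  ... | y′ , good , zeros
    with lineSearch k (λ r → slack r y) (λ r → slack r y′) feasible zeros
  ...   | t , 0≤slack , inj₁ refl = y′ , good , λ r →
          subst (0ℚ ≤_) (endpoint (slack r y) (slack r y′)) (0≤slack r)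
    where
    endpoint : ∀ s s′ → (1ℚ - 1ℚ) * s + 1ℚ * s′ ≡ s′
    endpoint = solve-∀ ℚ-ring
  ...   | t , 0≤slack , inj₂ (r , s≢0 , hit) = descend N count≤N
    where
    y″ : Pt n
    y″ = segment t y y′

    still-zero : ∀ r → isZero y r ≡ true → isZero y″ r ≡ true
    still-zero r z with slack r y ℚ.≟ 0ℚ
    still-zero r z  | yes ≡0 = dec-true (slack r y″ ℚ.≟ 0ℚ) (trans (affine r t y y′)
      (trans (cong₂ (λ p q → (1ℚ - t) * p + t * q) ≡0 (zeros r ≡0)) (combination-0 t)))

    fewer : countFalse (isZero y″) ℕ.< countFalse (isZero y)
    fewer = countFalse-< (isZero y) (isZero y″) still-zero r
      (dec-false (slack r y ℚ.≟ 0ℚ) s≢0)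
      (dec-true (slack r y″ ℚ.≟ 0ℚ) (trans (affine r t y y′) hit))

    descend : ∀ N → countFalse (isZero y) ℕ.≤ N → ∃ λ y′ → Good y′ × All (λ f → 0ℚ ≤ f y′) slack
    descend zero    count≤0 = contradiction (ℕ.<-≤-trans fewer count≤0) λ ()
    descend (suc N) count≤N = round′ N y″ (ℕ.≤-pred (ℕ.<-≤-trans fewer count≤N))
      (λ s → subst (0ℚ ≤_) (sym (affine s t y y′)) (0≤slack s))

  round : ∀ y → All (λ f → 0ℚ ≤ f y) slack → ∃ λ y′ → Good y′ × All (λ f → 0ℚ ≤ f y′) slack
  round y = round′ _ y ℕ.≤-refl

-- Integer points of Minkowski sums.

isIntPt-toℚ : ∀ {n} {x : Pt n} (z : Fin n → ℤ) → (∀ i → x i ≡ toℚ (z i)) → IsIntPt x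
isIntPt-toℚ z x≡ i = z i , x≡ i

isIntPt-+ : ∀ {n} {x y z : Pt n} → (∀ i → x i ≡ y i + z i) → IsIntPt y → IsIntPt z → IsIntPt x
isIntPt-+ x≡y+z y-int z-int i =
  let a , y≡ = y-int i
      b , z≡ = z-int i
  in a ℤ.+ b , trans (x≡y+z i) (trans (cong₂ _+_ y≡ z≡) (sym (toℚ-+ a b)))

isAffine-slack : ∀ {n} (c : Pt n) β → IsAffine (λ y → β - dot c y)
isAffine-slack c β t x y = begin
  β - dot c (segment t x y)
    ≡⟨ cong (λ e → β - e) (trans (dot-+ c (λ i → (1ℚ - t) * x i) (λ i → t * y i))
         (cong₂ _+_ (dot-* c (1ℚ - t) x) (dot-* c t y))) ⟩
  β - ((1ℚ - t) * dot c x + t * dot c y)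
    ≡⟨ distribute β t (dot c x) (dot c y) ⟩
  (1ℚ - t) * (β - dot c x) + t * (β - dot c y) ∎
  where
  distribute : ∀ β t p q → β - ((1ℚ - t) * p + t * q) ≡ (1ℚ - t) * (β - p) + t * (β - q)
  distribute = solve-∀ ℚ-ring

isAffine-reflected : ∀ {n} {f : Pt n → ℚ} → (∀ y z → (∀ i → y i ≡ z i) → f y ≡ f z) →
  IsAffine f → ∀ (x : Pt n) → IsAffine (λ y → f (λ i → x i - y i))
isAffine-reflected f-cong affine x t y z =
  trans (f-cong _ _ (λ i → distribute t (x i) (y i) (z i)))
    (affine t (λ i → x i - y i) (λ i → x i - z i))
  where
  distribute : ∀ t x y z → x - ((1ℚ - t) * y + t * z) ≡ (1ℚ - t) * (x - y) + t * (x - z)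
  distribute = solve-∀ ℚ-ring

colSpan-∨ : ∀ {n m} (A : Matrix n m) T₁ T₂ →
            (ColSpan A T₁ ⊕ ColSpan A T₂) ≐ ColSpan A (λ j → T₁ j ∨ T₂ j)
colSpan-∨ {n} {m} A T₁ T₂ = to , from
  where
  T : Fin m → Bool
  T j = T₁ j ∨ T₂ j

  to : (ColSpan A T₁ ⊕ ColSpan A T₂) ⊆ ColSpan A T
  to v (v₁ , v₂ , v₁∈ , v₂∈ , v≡) = colSpan-resp A T v≡ (colSpan-+ A T
    (colSpan-mono A T₁ T (λ j → Bool.∨-conicalˡ (T₁ j) (T₂ j)) v₁∈)
    (colSpan-mono A T₂ T (λ j → Bool.∨-conicalʳ (T₁ j) (T₂ j)) v₂∈))

  from : ColSpan A T ⊆ (ColSpan A T₁ ⊕ ColSpan A T₂)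
  from v (c , c-off , v≡) =
    _ , _ , (c₁ , c₁-off , λ _ → refl) , (c₂ , c₂-off , λ _ → refl) ,
    λ i → trans (v≡ i) (trans
      (Σℚ.Σ-cong m (λ j → trans (cong (_* toℚ (A i j)) (c≡c₁+c₂ j))
        (ℚ.*-distribʳ-+ (toℚ (A i j)) (c₁ j) (c₂ j))))
      (Σℚ.Σ-+ m (λ j → c₁ j * toℚ (A i j)) (λ j → c₂ j * toℚ (A i j))))
    where
    c₁ c₂ : Fin m → ℚ
    c₁ j = if T₁ j then c j else 0ℚ
    c₂ j = if T₁ j then 0ℚ else c j

    c≡c₁+c₂ : ∀ j → c j ≡ c₁ j + c₂ j
    c≡c₁+c₂ j with T₁ j
    ... | true  = sym (ℚ.+-identityʳ (c j))
    ... | false = sym (ℚ.+-identityˡ (c j))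

    c₁-off : ∀ j → T₁ j ≡ false → c₁ j ≡ 0ℚ
    c₁-off j eq rewrite eq = refl

    c₂-off : ∀ j → T₂ j ≡ false → c₂ j ≡ 0ℚ
    c₂-off j eq with T₁ j in eq₁
    ... | true  = refl
    ... | false = c-off j (cong₂ _∨_ eq₁ eq)

-- The rational point `y` cancels when the two differences are added: what remains is the integer
-- vector x - z₁ - z₂, lying in the joint span.
jointRounding : ∀ {n m} (A : Matrix n m) → Unimodular A → ∀ T₁ T₂ (x z₁ z₂ : Fin n → ℤ) (y : Pt n) →
  ColSpan A T₁ (λ i → y i - toℚ (z₁ i)) →
  ColSpan A T₂ (λ i → (toℚ (x i) - y i) - toℚ (z₂ i)) →
  ∃ λ (u₁ : Fin n → ℤ) → ∃ λ (u₂ : Fin n → ℤ) →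
    ColSpan A T₁ (toℚ ∘ u₁) × ColSpan A T₂ (toℚ ∘ u₂) ×
    (∀ i → toℚ (x i) - (toℚ (z₁ i) + toℚ (u₁ i)) ≡ toℚ (z₂ i) + toℚ (u₂ i))
jointRounding {n} A unimodular T₁ T₂ x z₁ z₂ y y-z₁∈ rest-z₂∈ =
  let u₁ , u₂ , u₁∈ , u₂∈ , u≡ = splitIntegral A unimodular T₁ T₂ u u∈
  in u₁ , u₂ , u₁∈ , u₂∈ , λ i → rest-y′ (x i) (z₁ i) (z₂ i) (u₁ i) (u₂ i) (u≡ i)
  where
  toℚ-u : ∀ a p q → toℚ (a ℤ.+ (ℤ.- p ℤ.+ ℤ.- q)) ≡ toℚ a + (- toℚ p + - toℚ q)
  toℚ-u a p q = trans (toℚ-+ a (ℤ.- p ℤ.+ ℤ.- q))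
    (cong (toℚ a +_) (trans (toℚ-+ (ℤ.- p) (ℤ.- q)) (cong₂ _+_ (toℚ-neg p) (toℚ-neg q))))

  regroup : ∀ a y p q → a + (- p + - q) ≡ (y - p) + ((a - y) - q)
  regroup = solve-∀ ℚ-ring

  isolate : ∀ a p q v → a - (p + v) ≡ q + ((a + (- p + - q)) - v)
  isolate = solve-∀ ℚ-ring

  cancel : ∀ q v w → q + ((v + w) - v) ≡ q + w
  cancel = solve-∀ ℚ-ring

  rest-y′ : ∀ a p q v w → a ℤ.+ (ℤ.- p ℤ.+ ℤ.- q) ≡ v ℤ.+ w →
            toℚ a - (toℚ p + toℚ v) ≡ toℚ q + toℚ w
  rest-y′ a p q v w eq = begin
    toℚ a - (toℚ p + toℚ v)
      ≡⟨ isolate (toℚ a) (toℚ p) (toℚ q) (toℚ v) ⟩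
    toℚ q + ((toℚ a + (- toℚ p + - toℚ q)) - toℚ v)
      ≡⟨ cong (λ e → toℚ q + (e - toℚ v))
           (trans (sym (toℚ-u a p q)) (trans (cong toℚ eq) (toℚ-+ v w))) ⟩
    toℚ q + ((toℚ v + toℚ w) - toℚ v)
      ≡⟨ cancel (toℚ q) (toℚ v) (toℚ w) ⟩
    toℚ q + toℚ w ∎

  u : Fin n → ℤ
  u i = x i ℤ.+ (ℤ.- z₁ i ℤ.+ ℤ.- z₂ i)

  u∈ : ColSpan A (λ j → T₁ j ∨ T₂ j) (toℚ ∘ u)
  u∈ = proj₁ (colSpan-∨ A T₁ T₂) (toℚ ∘ u)
    ((λ i → y i - toℚ (z₁ i)) , (λ i → (toℚ (x i) - y i) - toℚ (z₂ i)) , y-z₁∈ , rest-z₂∈ , λ i →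
      trans (toℚ-u (x i) (z₁ i) (z₂ i)) (regroup (toℚ (x i)) (y i) (toℚ (z₁ i)) (toℚ (z₂ i))))

module _ {n m} (A : Matrix n m) (unimodular : Unimodular A) {P₁ P₂ : PSet n}
  (P₁∈ : InPA A P₁) (P₂∈ : InPA A P₂) where

  private
    k = proj₁ (proj₁ (proj₁ P₁∈))
    C = proj₁ (proj₂ (proj₁ (proj₁ P₁∈)))
    b = proj₁ (proj₂ (proj₂ (proj₁ (proj₁ P₁∈))))
    P₁≐ = proj₂ (proj₂ (proj₂ (proj₁ (proj₁ P₁∈))))
    l = proj₁ (proj₁ (proj₁ P₂∈))
    D = proj₁ (proj₂ (proj₁ (proj₁ P₂∈)))
    d = proj₁ (proj₂ (proj₂ (proj₁ (proj₁ P₂∈))))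
    P₂≐ = proj₂ (proj₂ (proj₂ (proj₁ (proj₁ P₂∈))))

    zero-gap : ∀ {β γ} → γ ≡ β → β - γ ≡ 0ℚ
    zero-gap {β} refl = ℚ.+-inverseʳ β

  -- Only y is moved; the second summand is carried along as x - y, so the two add up to x
  -- throughout and the constraints of `P₂` become affine functions of y.
  integerDecomposition : ∀ (x : Fin n → ℤ) → (P₁ ⊕ P₂) (toℚ ∘ x) →
    ∃ λ y → IsIntPt y × IsIntPt (λ i → toℚ (x i) - y i) × P₁ y × P₂ (λ i → toℚ (x i) - y i)
  integerDecomposition x (y₀ , z₀ , y₀∈ , z₀∈ , x≡) =
    let y , (y-int , x-y-int) , feasible = Rounding.round slack
          (All.++⁺ IsAffine {slack₁} {slack₂} affine₁ affine₂) Good propose y₀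
          (feasible⁺ y₀ y₀∈ (polyhedron-resp (proj₁ (proj₁ P₂∈))
            (λ i → difference (toℚ (x i)) (y₀ i) (z₀ i) (x≡ i)) z₀∈))
        y∈ , x-y∈ = feasible⁻ y feasible
    in y , y-int , x-y-int , y∈ , x-y∈
    where
    rest : Pt n → Pt n
    rest y i = toℚ (x i) - y i

    Good : PSet n
    Good y = IsIntPt y × IsIntPt (rest y)

    slack₁ : Vector (Pt n → ℚ) k
    slack₁ r y = b r - dot (C r) y

    slack₂ : Vector (Pt n → ℚ) l
    slack₂ r y = d r - dot (D r) (rest y)

    slack : Vector (Pt n → ℚ) (k ℕ.+ l)
    slack = slack₁ ++ slack₂

    affine₁ : All IsAffine slack₁
    affine₁ r = isAffine-slack (C r) (b r)

    affine₂ : All IsAffine slack₂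
    affine₂ r = isAffine-reflected (λ _ _ y≗z → cong (λ e → d r - e) (dot-cong (D r) y≗z))
      (isAffine-slack (D r) (d r)) (toℚ ∘ x)

    feasible⁺ : ∀ y → P₁ y → P₂ (rest y) → All (λ f → 0ℚ ≤ f y) slack
    feasible⁺ y y∈ rest∈ = All.++⁺ (λ f → 0ℚ ≤ f y) {slack₁} {slack₂}
      (λ r → ≤⇒0≤- (proj₁ P₁≐ y y∈ r)) (λ r → ≤⇒0≤- (proj₁ P₂≐ (rest y) rest∈ r))

    feasible⁻ : ∀ y → All (λ f → 0ℚ ≤ f y) slack → P₁ y × P₂ (rest y)
    feasible⁻ y feasible =
      proj₂ P₁≐ y (λ r → 0≤-⇒≤ (All.++⁻ˡ (λ f → 0ℚ ≤ f y) slack₁ {slack₂} feasible r)) ,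
      proj₂ P₂≐ (rest y) (λ r → 0≤-⇒≤ (All.++⁻ʳ (λ f → 0ℚ ≤ f y) slack₁ {slack₂} feasible r))

    propose : ∀ y → All (λ f → 0ℚ ≤ f y) slack →
      ∃ λ y′ → Good y′ × All (λ f → f y ≡ 0ℚ → f y′ ≡ 0ℚ) slack
    propose y feasible =
      let y∈ , rest∈ = feasible⁻ y feasible
      in combine (integerPointOfActiveFace A P₁∈ y y∈) (integerPointOfActiveFace A P₂∈ (rest y) rest∈)
      where
      combine : _ → _ → ∃ λ y′ → Good y′ × All (λ f → f y ≡ 0ℚ → f y′ ≡ 0ℚ) slack
      combine (T₁ , z₁ , y-z₁∈ , active₁) (T₂ , z₂ , rest-z₂∈ , active₂) =
        move (jointRounding A unimodular T₁ T₂ x z₁ z₂ y y-z₁∈ rest-z₂∈)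
        where
        move : _ → ∃ λ y′ → Good y′ × All (λ f → f y ≡ 0ℚ → f y′ ≡ 0ℚ) slack
        move (u₁ , u₂ , u₁∈ , u₂∈ , rest≡) =
          y′ ,
          (isIntPt-toℚ (λ i → z₁ i ℤ.+ u₁ i) (λ i → sym (toℚ-+ (z₁ i) (u₁ i))) ,
           isIntPt-toℚ (λ i → z₂ i ℤ.+ u₂ i) (λ i → trans (rest≡ i) (sym (toℚ-+ (z₂ i) (u₂ i))))) ,
          All.++⁺ (λ f → f y ≡ 0ℚ → f y′ ≡ 0ℚ) {slack₁} {slack₂} zeros₁ zeros₂
          where
          y′ : Pt n
          y′ i = toℚ (z₁ i) + toℚ (u₁ i)

          zeros₁ : ∀ r → slack₁ r y ≡ 0ℚ → slack₁ r y′ ≡ 0ℚ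
          zeros₁ r ≡0 = zero-gap {b r} {dot (C r) y′}
            (active₁ (toℚ ∘ u₁) u₁∈ r (-≡0⇒≡ {dot (C r) y} {b r} ≡0))

          zeros₂ : ∀ r → slack₂ r y ≡ 0ℚ → slack₂ r y′ ≡ 0ℚ
          zeros₂ r ≡0 = zero-gap {d r} {dot (D r) (rest y′)} (trans (dot-cong (D r) rest≡)
            (active₂ (toℚ ∘ u₂) u₂∈ r (-≡0⇒≡ {dot (D r) (rest y)} {d r} ≡0)))

  ⊕-∩ℤ : ((P₁ ⊕ P₂) ∩ℤ) ≐ ((P₁ ∩ℤ) ⊕ (P₂ ∩ℤ))
  ⊕-∩ℤ = to , from
    where
    to : ((P₁ ⊕ P₂) ∩ℤ) ⊆ ((P₁ ∩ℤ) ⊕ (P₂ ∩ℤ))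
    to x ((y₀ , z₀ , y₀∈ , z₀∈ , x≡y₀+z₀) , x-int) =
      let X = λ i → proj₁ (x-int i)
          x≡ = λ i → proj₂ (x-int i)
          y , y-int , z-int , y∈ , z∈ = integerDecomposition X
            (y₀ , z₀ , y₀∈ , z₀∈ , λ i → trans (sym (x≡ i)) (x≡y₀+z₀ i))
      in y , (λ i → toℚ (X i) - y i) , (y∈ , y-int) , (z∈ , z-int) ,
         λ i → trans (x≡ i) (p≡q+[p-q] (toℚ (X i)) (y i))

    from : ((P₁ ∩ℤ) ⊕ (P₂ ∩ℤ)) ⊆ ((P₁ ⊕ P₂) ∩ℤ)
    from x (y , z , (y∈ , y-int) , (z∈ , z-int) , x≡) =
      (y , z , y∈ , z∈ , x≡) , isIntPt-+ x≡ y-int z-int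

  isIntegerPolyhedron-⊕ : IsIntegerPolyhedron (P₁ ⊕ P₂)
  isIntegerPolyhedron-⊕ = poly , to , from
    where
    poly : IsPolyhedron (P₁ ⊕ P₂)
    poly = isPolyhedron-⊕ (proj₁ (proj₁ P₁∈)) (proj₁ (proj₁ P₂∈))

    to : (P₁ ⊕ P₂) ⊆ Conv ((P₁ ⊕ P₂) ∩ℤ)
    to x (y , z , y∈ , z∈ , x≡) = Conv-mono (proj₂ ⊕-∩ℤ) x (Conv-⊕ x
      (y , z , proj₁ (proj₂ (proj₁ P₁∈)) y y∈ , proj₁ (proj₂ (proj₁ P₂∈)) z z∈ , x≡))

    from : Conv ((P₁ ⊕ P₂) ∩ℤ) ⊆ (P₁ ⊕ P₂)
    from x x∈ = Conv-polyhedron poly x (Conv-mono {S = (P₁ ⊕ P₂) ∩ℤ} {P₁ ⊕ P₂} (λ _ → proj₁) x x∈)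

-- Faces of Minkowski sums

IsConvex : ∀ {n} → PSet n → Set
IsConvex F = ∀ α β x y → 0ℚ ≤ α → 0ℚ ≤ β → α + β ≡ 1ℚ → F x → F y → F (λ i → α * x i + β * y i)

dot-combination : ∀ {n} (c : Pt n) α β x y →
                  dot c (λ i → α * x i + β * y i) ≡ α * dot c x + β * dot c y
dot-combination c α β x y = trans (dot-+ c (λ i → α * x i) (λ i → β * y i))
  (cong₂ _+_ (dot-* c α x) (dot-* c β y))

weights-cancel : ∀ α β γ → α + β ≡ 1ℚ → α * γ + β * γ ≡ γ
weights-cancel α β γ α+β≡1 =
  trans (sym (ℚ.*-distribʳ-+ γ α β)) (trans (cong (_* γ) α+β≡1) (ℚ.*-identityˡ γ))

isConvex-face : ∀ {n} {P : PSet n} → IsPolyhedron P → ∀ c δ → IsConvex (λ x → P x × dot c x ≡ δ)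
isConvex-face (k , C , b , P⇒ , ⇒P) c δ α β x y 0≤α 0≤β α+β≡1 (x∈P , cx≡δ) (y∈P , cy≡δ) =
  ⇒P _ (λ r → subst₂ _≤_ (sym (dot-combination (C r) α β x y)) (weights-cancel α β (b r) α+β≡1)
    (ℚ.+-mono-≤ (*-monoˡ α 0≤α (P⇒ x x∈P r)) (*-monoˡ β 0≤β (P⇒ y y∈P r)))) ,
  trans (dot-combination c α β x y)
    (trans (cong₂ (λ p q → α * p + β * q) cx≡δ cy≡δ) (weights-cancel α β δ α+β≡1))

-- Replacing x and y by the points dividing the segment xy in the ratios
-- L − l : L + l and L + l : L − l scales x − y by l / L.
rescale : ∀ {n} {F : PSet n} → IsConvex F → ∀ l L → 0ℚ < L → l ≤ L → - l ≤ L →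
  ∀ x y → F x → F y →
  ∃ λ x′ → ∃ λ y′ → F x′ × F y′ × (∀ i → l * (x i - y i) ≡ L * (x′ i - y′ i))
rescale {n} {F} convex l L 0<L l≤L -l≤L x y x∈F y∈F =
  _ , _ , convex α β x y 0≤α 0≤β α+β≡1 x∈F y∈F ,
  convex β α x y 0≤β 0≤α (trans (ℚ.+-comm β α) α+β≡1) x∈F y∈F ,
  λ i → trans (cong (λ e → e * (x i - y i)) l≡) (regroup L κ l (x i) (y i))
  where
  0<L+L : 0ℚ < L + L
  0<L+L = ℚ.+-mono-< 0<L 0<L

  κ-exists : ∃ λ κ → (L + L) * κ ≡ 1ℚ
  κ-exists = *-solve (λ eq → ℚ.<⇒≢ 0<L+L (sym eq)) 1ℚ

  κ α β : ℚ
  κ = proj₁ κ-exists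
  α = κ * (L + l)
  β = κ * (L - l)

  0≤κ : 0ℚ ≤ κ
  0≤κ = ℚ.*-cancelˡ-≤-pos (L + L) {{ℚ.positive 0<L+L}}
    (subst₂ _≤_ (sym (ℚ.*-zeroʳ (L + L))) (sym (proj₂ κ-exists)) 0≤1)

  0≤β : 0ℚ ≤ β
  0≤β = 0≤-* 0≤κ (≤⇒0≤- l≤L)

  0≤α : 0ℚ ≤ α
  0≤α = 0≤-* 0≤κ (subst (0ℚ ≤_) (double-neg L l) (≤⇒0≤- -l≤L))
    where
    double-neg : ∀ L l → L - (- l) ≡ L + l
    double-neg = solve-∀ ℚ-ring

  α+β≡1 : α + β ≡ 1ℚ
  α+β≡1 = trans (collect κ L l) (proj₂ κ-exists)
    where
    collect : ∀ κ L l → κ * (L + l) + κ * (L - l) ≡ (L + L) * κ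
    collect = solve-∀ ℚ-ring

  l≡ : l ≡ ((L + L) * κ) * l
  l≡ = trans (sym (ℚ.*-identityˡ l)) (cong (_* l) (sym (proj₂ κ-exists)))

  regroup : ∀ L κ l x y → (((L + L) * κ) * l) * (x - y) ≡
    L * ((κ * (L + l) * x + κ * (L - l) * y) - (κ * (L - l) * x + κ * (L + l) * y))
  regroup = solve-∀ ℚ-ring

magnitude : ∀ l → ∃ λ M → 0ℚ ≤ M × l ≤ M × - l ≤ M
magnitude l with ℚ.≤-total 0ℚ l
... | inj₁ 0≤l = l , 0≤l , ℚ.≤-refl , ℚ.≤-trans (ℚ.neg-antimono-≤ 0≤l) 0≤l
... | inj₂ l≤0 = - l , ℚ.neg-antimono-≤ l≤0 , ℚ.≤-trans l≤0 (ℚ.neg-antimono-≤ l≤0) , ℚ.≤-refl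

-- `SpanOf` allows one scalar times one difference, so two such vectors can be added only over a
-- common scalar. `L` dominates both scalars in absolute value, and the summand 1 keeps it positive
-- when both vanish.
spanOf-⊕ : ∀ {n} {F₁ F₂ : PSet n} → IsConvex F₁ → IsConvex F₂ →
           (SpanOf F₁ ⊕ SpanOf F₂) ⊆ SpanOf (F₁ ⊕ F₂)
spanOf-⊕ convex₁ convex₂ v
  (v₁ , v₂ , (l₁ , x₁ , y₁ , x₁∈ , y₁∈ , v₁≡) , (l₂ , x₂ , y₂ , x₂∈ , y₂∈ , v₂≡) , v≡) =
  let M₁ , 0≤M₁ , l₁≤M₁ , -l₁≤M₁ = magnitude l₁
      M₂ , 0≤M₂ , l₂≤M₂ , -l₂≤M₂ = magnitude l₂
      L = (M₁ + M₂) + 1ℚ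
      M₁≤L = 0≤-⇒≤ (subst (0ℚ ≤_) (gap₁ M₁ M₂) (0≤-+ 0≤M₂ 0≤1))
      M₂≤L = 0≤-⇒≤ (subst (0ℚ ≤_) (gap₂ M₁ M₂) (0≤-+ 0≤M₁ 0≤1))
      0<L = ℚ.+-mono-≤-< (0≤-+ 0≤M₁ 0≤M₂) (ℚ.positive⁻¹ 1ℚ)
      x₁′ , y₁′ , x₁′∈ , y₁′∈ , eq₁ = rescale convex₁ l₁ L 0<L
        (ℚ.≤-trans l₁≤M₁ M₁≤L) (ℚ.≤-trans -l₁≤M₁ M₁≤L) x₁ y₁ x₁∈ y₁∈
      x₂′ , y₂′ , x₂′∈ , y₂′∈ , eq₂ = rescale convex₂ l₂ L 0<L
        (ℚ.≤-trans l₂≤M₂ M₂≤L) (ℚ.≤-trans -l₂≤M₂ M₂≤L) x₂ y₂ x₂∈ y₂∈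
  in L , (λ i → x₁′ i + x₂′ i) , (λ i → y₁′ i + y₂′ i) ,
     (x₁′ , x₂′ , x₁′∈ , x₂′∈ , λ _ → refl) , (y₁′ , y₂′ , y₁′∈ , y₂′∈ , λ _ → refl) ,
     λ i → trans (v≡ i) (trans
       (cong₂ _+_ (trans (v₁≡ i) (eq₁ i)) (trans (v₂≡ i) (eq₂ i)))
       (regroup L (x₁′ i) (y₁′ i) (x₂′ i) (y₂′ i)))
  where
  gap₁ : ∀ M₁ M₂ → M₂ + 1ℚ ≡ ((M₁ + M₂) + 1ℚ) - M₁
  gap₁ = solve-∀ ℚ-ring

  gap₂ : ∀ M₁ M₂ → M₁ + 1ℚ ≡ ((M₁ + M₂) + 1ℚ) - M₂
  gap₂ = solve-∀ ℚ-ring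

  regroup : ∀ L x y x′ y′ → L * (x - y) + L * (x′ - y′) ≡ L * ((x + x′) - (y + y′))
  regroup = solve-∀ ℚ-ring

spanOf-⊕⁻ : ∀ {n} {F₁ F₂ : PSet n} → SpanOf (F₁ ⊕ F₂) ⊆ (SpanOf F₁ ⊕ SpanOf F₂)
spanOf-⊕⁻ v (l , x , y , (x₁ , x₂ , x₁∈ , x₂∈ , x≡) , (y₁ , y₂ , y₁∈ , y₂∈ , y≡) , v≡) =
  _ , _ , (l , x₁ , y₁ , x₁∈ , y₁∈ , λ _ → refl) , (l , x₂ , y₂ , x₂∈ , y₂∈ , λ _ → refl) ,
  λ i → trans (v≡ i) (trans (cong₂ (λ p q → l * (p - q)) (x≡ i) (y≡ i))
    (regroup l (x₁ i) (y₁ i) (x₂ i) (y₂ i)))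
  where
  regroup : ∀ l x y x′ y′ → l * ((x + x′) - (y + y′)) ≡ l * (x - y) + l * (x′ - y′)
  regroup = solve-∀ ℚ-ring

spanOf-mono : ∀ {n} {F G : PSet n} → F ⊆ G → SpanOf F ⊆ SpanOf G
spanOf-mono F⊆G v (l , x , y , x∈ , y∈ , v≡) = l , x , y , F⊆G x x∈ , F⊆G y y∈ , v≡

⊕-mono : ∀ {n} {S S′ T T′ : PSet n} → S ⊆ S′ → T ⊆ T′ → (S ⊕ T) ⊆ (S′ ⊕ T′)
⊕-mono S⊆S′ T⊆T′ x (y , z , y∈ , z∈ , x≡) = y , z , S⊆S′ y y∈ , T⊆T′ z z∈ , x≡

≤-+-tight : ∀ {p q α β} → p ≤ α → q ≤ β → p + q ≡ α + β → p ≡ α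
≤-+-tight {p} {q} {α} {β} p≤α q≤β p+q≡α+β =
  ℚ.≤-antisym p≤α (0≤-⇒≤ (subst (0ℚ ≤_) gap (≤⇒0≤- q≤β)))
  where
  shift : ∀ p q α β → β - q ≡ (p - α) + ((α + β) - (p + q))
  shift = solve-∀ ℚ-ring

  gap : β - q ≡ p - α
  gap = begin
    β - q                            ≡⟨ shift p q α β ⟩
    (p - α) + ((α + β) - (p + q))    ≡⟨ cong (λ e → (p - α) + (e - (p + q))) (sym p+q≡α+β) ⟩
    (p - α) + ((p + q) - (p + q))    ≡⟨ cong ((p - α) +_) (ℚ.+-inverseʳ (p + q)) ⟩
    (p - α) + 0ℚ                     ≡⟨ ℚ.+-identityʳ (p - α) ⟩
    p - α                            ∎

-- A face is nonempty, so one of its points splits as y + z. Since y + z maximises `c` over the sum,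
-- varying one summand with the other fixed shows that y and z are maximisers too; their values
-- serve as `δ₁` and `δ₂`.
face-⊕ : ∀ {n} {P₁ P₂ F : PSet n} → IsFace (P₁ ⊕ P₂) F →
  ∃ λ c → ∃ λ δ₁ → ∃ λ δ₂ →
    IsFace P₁ (λ x → P₁ x × dot c x ≡ δ₁) × IsFace P₂ (λ x → P₂ x × dot c x ≡ δ₂) ×
    F ≐ ((λ x → P₁ x × dot c x ≡ δ₁) ⊕ (λ x → P₂ x × dot c x ≡ δ₂))
face-⊕ {n} {P₁} {P₂} {F} ((x , x∈F) , c , δ , bound , F⇒ , ⇒F)
  with (y , z , y∈ , z∈ , x≡) , cx≡δ ← F⇒ x x∈F =
  c , dot c y , dot c z ,
  ((y , y∈ , refl) , c , dot c y , bound₁ , (λ _ f → f) , (λ _ f → f)) ,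
  ((z , z∈ , refl) , c , dot c z , bound₂ , (λ _ f → f) , (λ _ f → f)) ,
  to , from
  where
  δ≡ : dot c y + dot c z ≡ δ
  δ≡ = trans (sym (dot-+ c y z)) (trans (sym (dot-cong c x≡)) cx≡δ)

  sum-bound : ∀ p q → P₁ p → P₂ q → dot c p + dot c q ≤ dot c y + dot c z
  sum-bound p q p∈ q∈ = subst₂ _≤_ (dot-+ c p q) (sym δ≡)
    (bound (λ i → p i + q i) (p , q , p∈ , q∈ , λ _ → refl))

  cancelʳ : ∀ {p q} r → p + r ≤ q + r → p ≤ q
  cancelʳ {p} {q} r p+r≤q+r = 0≤-⇒≤ (subst (0ℚ ≤_) (cancel p q r) (≤⇒0≤- p+r≤q+r))
    where
    cancel : ∀ p q r → (q + r) - (p + r) ≡ q - p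
    cancel = solve-∀ ℚ-ring

  bound₁ : ∀ p → P₁ p → dot c p ≤ dot c y
  bound₁ p p∈ = cancelʳ (dot c z) (sum-bound p z p∈ z∈)

  bound₂ : ∀ q → P₂ q → dot c q ≤ dot c z
  bound₂ q q∈ = cancelʳ (dot c y)
    (subst₂ _≤_ (ℚ.+-comm (dot c y) (dot c q)) (ℚ.+-comm (dot c y) (dot c z)) (sum-bound y q y∈ q∈))

  to : F ⊆ ((λ x → P₁ x × dot c x ≡ dot c y) ⊕ (λ x → P₂ x × dot c x ≡ dot c z))
  to w w∈F with (p , q , p∈ , q∈ , w≡) , cw≡δ ← F⇒ w w∈F =
    p , q , (p∈ , ≤-+-tight (bound₁ p p∈) (bound₂ q q∈) sums) ,
    (q∈ , ≤-+-tight (bound₂ q q∈) (bound₁ p p∈)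
      (trans (ℚ.+-comm (dot c q) (dot c p)) (trans sums (ℚ.+-comm (dot c y) (dot c z))))) , w≡
    where
    sums : dot c p + dot c q ≡ dot c y + dot c z
    sums = trans (sym (dot-+ c p q)) (trans (sym (dot-cong c w≡)) (trans cw≡δ (sym δ≡)))

  from : ((λ x → P₁ x × dot c x ≡ dot c y) ⊕ (λ x → P₂ x × dot c x ≡ dot c z)) ⊆ F
  from w (p , q , (p∈ , cp≡) , (q∈ , cq≡) , w≡) = ⇒F w ((p , q , p∈ , q∈ , w≡) ,
    trans (dot-cong c w≡) (trans (dot-+ c p q) (trans (cong₂ _+_ cp≡ cq≡) δ≡)))

inPA-⊕ : ∀ {n m} (A : Matrix n m) → Unimodular A → ∀ {P₁ P₂} → InPA A P₁ → InPA A P₂ →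
         InPA A (P₁ ⊕ P₂)
inPA-⊕ A unimodular P₁∈ P₂∈ = isIntegerPolyhedron-⊕ A unimodular P₁∈ P₂∈ , λ F face →
  let c , δ₁ , δ₂ , face₁ , face₂ , F⊆ , ⊆F = face-⊕ face
      T₁ , span₁⊆ , ⊆span₁ = proj₂ P₁∈ _ face₁
      T₂ , span₂⊆ , ⊆span₂ = proj₂ P₂∈ _ face₂
      sum⊆ , ⊆sum = colSpan-∨ A T₁ T₂
  in (λ j → T₁ j ∨ T₂ j) ,
     (λ v v∈ → sum⊆ v (⊕-mono span₁⊆ span₂⊆ v (spanOf-⊕⁻ v (spanOf-mono F⊆ v v∈)))) ,
     (λ v v∈ → spanOf-mono ⊆F v (spanOf-⊕
       (isConvex-face (proj₁ (proj₁ P₁∈)) c δ₁) (isConvex-face (proj₁ (proj₁ P₂∈)) c δ₂) v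
       (⊕-mono ⊆span₁ ⊆span₂ v (⊆sum v v∈))))

-- Passage between polyhedra and their integer points.

Conv-cong : ∀ {n} {S T : PSet n} → S ≐ T → Conv S ≐ Conv T
Conv-cong (S⊆T , T⊆S) = Conv-mono S⊆T , Conv-mono T⊆S

∩ℤ-cong : ∀ {n} {P Q : PSet n} → P ≐ Q → (P ∩ℤ) ≐ (Q ∩ℤ)
∩ℤ-cong (P⊆Q , Q⊆P) = (λ x (x∈ , int) → P⊆Q x x∈ , int) , (λ x (x∈ , int) → Q⊆P x x∈ , int)

theorem3p1 : (n m : ℕ) (A : Matrix n m) → Unimodular A → RankFull A →
    ((P : PSet n) → InPA A P → IsIntegerPolyhedron P) ×
    ((P₁ P₂ : PSet n) → InPA A P₁ → InPA A P₂ →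
    InPA A (P₁ ⊕ P₂) × (((P₁ ⊕ P₂) ∩ℤ) ≐ ((P₁ ∩ℤ) ⊕ (P₂ ∩ℤ)))) ×
    ((S : PSet n) → InCA A S → IsIntegerPolyhedron (Conv S) × (S ≐ (Conv S ∩ℤ))) ×
    ((S₁ S₂ : PSet n) → InCA A S₁ → InCA A S₂ → InCA A (S₁ ⊕ S₂))
theorem3p1 n m A unimodular _ =
  (λ P → proj₁) ,
  (λ P₁ P₂ P₁∈ P₂∈ → inPA-⊕ A unimodular P₁∈ P₂∈ , ⊕-∩ℤ A unimodular P₁∈ P₂∈) ,
  -- Since `P` is the hull of its integer points, `Conv S` is `P` again, and both claims are
  -- transported from `P`.
  (λ S (P , ((poly , P≐) , _) , S≐) →
    let ConvS≐P = ≐-trans (Conv-cong S≐) (≐-sym P≐)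
        S≐ConvS∩ℤ = ≐-trans S≐ (∩ℤ-cong (≐-sym ConvS≐P))
    in (isPolyhedron-≐ ConvS≐P poly , Conv-cong S≐ConvS∩ℤ) , S≐ConvS∩ℤ) ,
  (λ S₁ S₂ (P₁ , P₁∈ , S₁⊆ , ⊆S₁) (P₂ , P₂∈ , S₂⊆ , ⊆S₂) →
    P₁ ⊕ P₂ , inPA-⊕ A unimodular P₁∈ P₂∈ ,
    ≐-trans (⊕-mono S₁⊆ S₂⊆ , ⊕-mono ⊆S₁ ⊆S₂) (≐-sym (⊕-∩ℤ A unimodular P₁∈ P₂∈)))
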